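{- Let $n\ge 1$. For every $j=1,\ldots,n+1$, the number $v_j^n$ of non-crossing partitions with $n$ vertices (points in convex position) whose root vertex has isolation degree $j-1$ is $$v_{j}^{n} = \frac{j}{n+1}\sum_{k=\left\lceil\frac{n+j+1}{2}\right\rceil}^{n+1}\binom{n+1}{k}\binom{k-j-1}{2k-n-j-1}2^{2k-n-j-1}.$$
   Context: A partition of $[n]=\{1,\dots,n\}$ into nonempty, pairwise disjoint blocks is non-crossing if whenever $1\le a<b<c<d\le n$ are such that $a,c$ are in the same block and $b,d$ are in the same block, the two blocks coincide. A non-crossing partition is drawn as a plane geometric graph (straight-line edges that do not cross) on points $p_1,\dots,p_n$ in convex position labelled in counter-clockwise order: each block with at least three elements is drawn as the convex polygon (cycle) through its points, a block of size two as the edge joining its two points, and a block of size one as an isolated vertex. Two vertices are visible (from each other) if the line segment connecting them does not intersect the interior of any edge of the graph. The isolation degree of the root vertex $p_n$ is the number of isolated vertices (singleton blocks) that are visible from an additional vertex $p_{n+1}$ inserted between $p_n$ and $p_1$ in convex position. Binomial coefficients are generalized: $\binom{a}{m}=\frac{a(a-1)\cdots(a-m+1)}{m!}$ for any integer $a$ and integer $m\ge 0$; in particular $\binom{ -1}{0}=1$. -}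

module Defs where

open import Algebra.Apartness.Bundles using (HeytingField)
open import Data.Fin.Base as Fin using (Fin; inject₁; fromℕ)
open import Data.Fin.Subset using (Subset; _∈_; _∩_; ⁅_⁆; ∣_∣; Nonempty; Empty)
open import Data.Integer.Base as ℤ using (ℤ; +_; 1ℤ)
open import Data.List.Base using (List; foldr; applyUpTo)
open import Data.List.Membership.Propositional using () renaming (_∈_ to _∈ₗ_)
open import Data.List.Relation.Binary.BagAndSetEquality using ([_]-Equality; set)
open import Data.List.Relation.Unary.All using (All)
open import Data.List.Relation.Unary.AllPairs using (AllPairs)
open import Data.List.Relation.Unary.Any using (Any)
open import Data.Nat.Base as ℕ using (ℕ; zero; suc; _!)
open import Data.Nat.Properties using (_!≢0)
open import Data.Product.Base using (Σ; ∃; ∃₂; _×_; _,_; proj₁)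
open import Data.Rational.Base as ℚ using (ℚ; 0ℚ)
open import Data.Sum.Base using (_⊎_)
open import Function.Base using (_∘_)
open import Function.Bundles using (Bijection; _⇔_)
open import Level using (Level; _⊔_) renaming (suc to lsuc)
open import Relation.Binary.Bundles using (Setoid)
open import Relation.Binary.Core using (Rel)
import Relation.Binary.Construct.On as On
open import Relation.Binary.PropositionalEquality using (_≡_; setoid)
open import Relation.Binary.Structures using (IsStrictPartialOrder)
open import Relation.Nullary.Negation using (¬_)

-- The drawings live in the plane over an ordered field.  The library has no
-- real numbers; the axioms are chosen so that ℚ, the constructive reals and
-- every classical ordered field (in particular ℝ) satisfy them: the order is
-- not assumed decidable, and is total only up to apartness.
record OrderedField c ℓ₁ ℓ₂ ℓ₃ : Set (lsuc (c ⊔ ℓ₁ ⊔ ℓ₂ ⊔ ℓ₃)) where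
  field
    heytingField : HeytingField c ℓ₁ ℓ₂

  open HeytingField heytingField public

  infix 4 _<_ _≤_
  field
    _<_                  : Rel Carrier ℓ₃
    isStrictPartialOrder : IsStrictPartialOrder _≈_ _<_
    #⇒<⊎>                : ∀ {x y} → x # y → x < y ⊎ y < x
    <⇒#                  : ∀ {x y} → x < y → x # y
    +-monoˡ-<            : ∀ z {x y} → x < y → x + z < y + z
    *-pos                : ∀ {x y} → 0# < x → 0# < y → 0# < x * y

  _≤_ : Rel Carrier ℓ₃
  x ≤ y = ¬ (y < x)

record Partition (n : ℕ) : Set where
  field
    blocks   : List (Subset n)
    nonempty : All Nonempty blocks
    disjoint : AllPairs (λ B C → Empty (B ∩ C)) blocks
    covers   : ∀ i → Any (i ∈_) blocks

open Partition public

NonCrossing : ∀ {n} → Partition n → Set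
NonCrossing P = ∀ {a b c d B C} → a Fin.< b → b Fin.< c → c Fin.< d →
  B ∈ₗ blocks P → C ∈ₗ blocks P →
  a ∈ B → c ∈ B → b ∈ C → d ∈ C → B ≡ C

Isolated : ∀ {n} → Partition n → Fin n → Set
Isolated P i = ⁅ i ⁆ ∈ₗ blocks P

-- The edges, each listed with its smaller endpoint first.  A block is drawn as
-- the cycle through its points, so x and y are joined when they are successive
-- elements of a block, or its least and its greatest element.  In a block of
-- size two both alternatives describe its only edge.
Edge : ∀ {n} → Partition n → Fin n → Fin n → Set
Edge P x y = x Fin.< y × ∃ λ B → B ∈ₗ blocks P × x ∈ B × y ∈ B ×
  ((∀ {z} → z ∈ B → z Fin.≤ x ⊎ y Fin.≤ z) ⊎
   (∀ {z} → z ∈ B → x Fin.≤ z × z Fin.≤ y))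

module Plane {c ℓ₁ ℓ₂ ℓ₃} (F : OrderedField c ℓ₁ ℓ₂ ℓ₃) where
  open OrderedField F

  Point : Set c
  Point = Carrier × Carrier

  infix 4 _≋_
  _≋_ : Rel Point ℓ₁
  (x , y) ≋ (x′ , y′) = x ≈ x′ × y ≈ y′

  -- Twice the signed area of the triangle u v w; positive exactly when u, v, w
  -- make a left turn.
  orient : Point → Point → Point → Carrier
  orient (u₁ , u₂) (v₁ , v₂) (w₁ , w₂) =
    (v₁ - u₁) * (w₂ - u₂) - (v₂ - u₂) * (w₁ - u₁)

  -- The points are in (strictly) convex position and labelled in
  -- counter-clockwise order.
  Convex : ∀ {m} → (Fin m → Point) → Set ℓ₃
  Convex p = ∀ {i j k} → i Fin.< j → j Fin.< k → 0# < orient (p i) (p j) (p k)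

  lerp : Carrier → Point → Point → Point
  lerp t (u₁ , u₂) (v₁ , v₂) =
    ((1# - t) * u₁ + t * v₁) , ((1# - t) * u₂ + t * v₂)

  OnSegment : Point → Point → Point → Set (c ⊔ ℓ₁ ⊔ ℓ₃)
  OnSegment u v x = ∃ λ t → 0# ≤ t × t ≤ 1# × x ≋ lerp t u v

  InsideSegment : Point → Point → Point → Set (c ⊔ ℓ₁ ⊔ ℓ₃)
  InsideSegment u v x = ∃ λ t → 0# < t × t < 1# × x ≋ lerp t u v

  Visible : ∀ {n} → Partition n → (Fin n → Point) →
            Point → Point → Set (c ⊔ ℓ₁ ⊔ ℓ₃)
  Visible P p u v = ¬ (∃₂ λ x y → Edge P x y ×
    ∃ λ z → OnSegment u v z × InsideSegment (p x) (p y) z)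

  -- The configuration p lists the n points of the drawing followed by the
  -- additional point, which therefore lies between the last and the first.
  HasIsolationDegree : ∀ {n} → (Fin (suc n) → Point) → Partition n → ℕ →
                       Set (c ⊔ ℓ₁ ⊔ ℓ₃)
  HasIsolationDegree {n} p P d = Σ (Subset n) λ S →
    (∀ i → i ∈ S ⇔
      (Isolated P i × Visible P (p ∘ inject₁) (p (inject₁ i)) (p (fromℕ n)))) ×
    ∣ S ∣ ≡ d

  -- Two partitions are equal when they have the same set of blocks: neither
  -- the order in which blocks are listed nor the proofs carried matter.
  NonCrossingOfDegree : ∀ n → (Fin (suc n) → Point) → ℕ →
                        Setoid (c ⊔ ℓ₁ ⊔ ℓ₃) Level.zero
  NonCrossingOfDegree n p d = On.setoid ([ set ]-Equality (Subset n)) underlying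
    where
    underlying : (Σ (Partition n) λ P → NonCrossing P × HasIsolationDegree p P d) →
                 List (Subset n)
    underlying = blocks ∘ proj₁

HasCardinality : ∀ {a ℓ} → Setoid a ℓ → ℕ → Set (a ⊔ ℓ)
HasCardinality S v = Bijection (setoid (Fin v)) S

fromℕ/1 : ℕ → ℚ
fromℕ/1 m = + m ℚ./ 1

-- a (a - 1) ⋯ (a - m + 1)
fallingFactorial : ℤ → ℕ → ℤ
fallingFactorial a zero    = 1ℤ
fallingFactorial a (suc m) = fallingFactorial a m ℤ.* (a ℤ.- + m)

binomial : ℤ → ℕ → ℚ
binomial a m = (fallingFactorial a m ℚ./ (m !)) {{m !≢0}}

-- The sum of f k over a ≤ k ≤ b.
∑[_⋯_] : ℕ → ℕ → (ℕ → ℚ) → ℚ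
∑[ a ⋯ b ] f = foldr ℚ._+_ 0ℚ (applyUpTo (λ i → f (a ℕ.+ i)) (suc b ℕ.∸ a))

{-# OPTIONS --safe #-}

-- By convexity an isolated vertex is visible from the additional point exactly
-- when no block has elements on both sides of it: otherwise the edge from the
-- least to the greatest element of such a block cuts the line of sight.  Delete
-- the first vertex of a non-crossing partition and break up its block into
-- singletons: all of these become visible, and conversely the first vertex may
-- be joined to an arbitrary set of visible singletons.  Only the singletons after
-- the last chosen one stay visible, so that
--   v_j^n = v_(j-1)^(n-1) + Σ_i 2^i v_(j+1+i)^(n-1),
-- which says that v_j^n = [z^(n+1)] w^j for w = z φ(w), φ = 1 + w² / (1 - 2w).
-- Lagrange inversion gives v_j^n = j/(n+1) [w^(n+1-j)] φ^(n+1); expanding the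
-- power of φ by the binomial theorem gives the formula.
module Submission where

open import Defs
open import Algebra.Bundles using (CommutativeRing)
open import Data.Bool.Base using (Bool; true)
open import Data.Empty using (⊥-elim)
open import Data.Fin.Base as Fin using (Fin; zero; suc; inject₁; fromℕ)
import Data.Fin.Properties as Fin
open import Data.Fin.Subset using (Subset; _∈_; _∉_; _⊆_; _∩_; ⊥; ⁅_⁆; ∣_∣; Nonempty; Empty; inside; outside)
open import Data.Fin.Subset.Properties
open import Data.Integer.Base as ℤ using (ℤ; +_; -[1+_]; _⊖_; 0ℤ; 1ℤ)
import Data.Integer.Properties as ℤ
import Data.Integer.Solver as ℤ
open import Data.List.Base as List using (List; []; _∷_; filter; foldr; applyUpTo)
open import Data.List.Membership.Propositional using (find; lose) renaming (_∈_ to _∈ₗ_)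
open import Data.List.Membership.Propositional.Properties using (∈-map⁺; ∈-map⁻; ∈-filter⁺; ∈-filter⁻)
open import Data.List.Relation.Unary.All as All using (All; []; _∷_)
import Data.List.Relation.Unary.All.Properties as All
open import Data.List.Relation.Unary.AllPairs as AllPairs using (AllPairs; []; _∷_)
import Data.List.Relation.Unary.AllPairs.Properties as AllPairs
open import Data.List.Relation.Unary.Any using (here; there)
import Data.Maybe.Base as Maybe
open import Data.Nat.Base as ℕ using (ℕ; zero; suc; z≤n; s≤s)
open import Data.Nat.Combinatorics using (_C_; nCk+nC[k+1]≡[n+1]C[k+1]; k>n⇒nCk≡0; nCn≡1)
open import Data.Nat.ListAction using (sum)
import Data.Nat.Properties as ℕ
import Data.Nat.Solver as ℕ
open import Data.Product.Base using (Σ; ∃; ∃₂; _×_; _,_; proj₁; proj₂; swap)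
open import Data.Product.Function.NonDependent.Propositional using (_×-↔_)
open import Data.Rational.Base as ℚ using (ℚ; 0ℚ; toℚᵘ)
import Data.Rational.Properties as ℚ
open import Data.Rational.Unnormalised.Base as ℚᵘ using (mkℚᵘ; *≡*)
import Data.Rational.Unnormalised.Properties as ℚᵘ
open import Data.Sum.Base as Sum using (_⊎_; inj₁; inj₂)
open import Data.Sum.Function.Propositional using (_⊎-↔_)
open import Data.Vec.Base as Vec using ([]; _∷_)
open import Data.Vec.Properties using (∷-injectiveˡ; ∷-injectiveʳ)
open import Function.Base using (_∘_; id)
open import Function.Bundles using (_⇔_; _↔_; mk⇔; mk↔ₛ′; Equivalence; Inverse)
import Function.Properties.Equivalence as ⇔
open import Function.Properties.Inverse using (↔-trans)
open import Relation.Binary.Definitions using (tri<; tri≈; tri>)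
open import Relation.Binary.PropositionalEquality as ≡ using (_≡_; module ≡-Reasoning)
open import Relation.Binary.Structures using (IsStrictPartialOrder)
open import Relation.Nullary.Decidable using (Dec; yes; no; ¬?; dec⇒maybe)
open import Relation.Nullary.Negation using (¬_; contradiction)

-- Partitions are equal when they have the same set of blocks, while the recursion has to produce
-- lists. Hence the combinatorics is done for predicates on subsets, and what is counted are
-- inductive codes that record, vertex by vertex, which outer singletons are joined to the new first
-- vertex. The possibilities at each step depend only on the number of these singletons, so the
-- count is a recurrence in two indices.
--
-- Lagrange inversion is carried out on coefficients. Multiplying the recurrence by 1 - 2w removes
-- its sum over powers of two and leaves a fixed number of terms; φ = (1 - w)² / (1 - 2w) gives a
-- recurrence of the same shape for the coefficients of φ^m. That the numbers j [w^(m-j)] φ^m obey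
-- the first recurrence amounts to m (φ^(m+1))′ = (m + 1) φ (φ^m)′. This identity is obtained from a
-- first-order differential equation for φ^m: its polynomial coefficients let induction and a ring
-- solver do the work.

open Equivalence using (to; from)

-- Ring identities with integer coefficients

-- A ring solver which can cancel terms although equality in the ring is not
-- decidable: its coefficients are integers.
module IntegerCoefficients {c ℓ} (R : CommutativeRing c ℓ) where
  open CommutativeRing R
  open import Algebra.Properties.Semiring.Mult.TCOptimised semiring using (1+×; ×-homo-+; ×1-homo-*) renaming (_×_ to infixl 8 _·_)
  open import Algebra.Properties.Ring ring
  open import Algebra.Properties.AbelianGroup +-abelianGroup using (⁻¹-∙-comm)
  open import Algebra.Solver.Ring.AlmostCommutativeRing
    using (fromCommutativeRing; _-Raw-AlmostCommutative⟶_)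
  open import Relation.Binary.Reasoning.Setoid setoid

  -- These are the multiples for which `1 · 1#` reduces to `1#`, so that `con 1ℤ` in a solver
  -- equation denotes `1#` itself.
  ⟦_⟧ : ℤ → Carrier
  ⟦ ℤ.+ n ⟧    = n · 1#
  ⟦ -[1+ n ] ⟧ = - (suc n · 1#)

  ⟦⟧-⊖ : ∀ m n → ⟦ m ⊖ n ⟧ ≈ m · 1# - n · 1#
  ⟦⟧-⊖ m zero = begin
    m · 1#        ≈⟨ +-identityʳ _ ⟨
    m · 1# + 0#   ≈⟨ +-congˡ -0#≈0# ⟨
    m · 1# - 0#   ∎
  ⟦⟧-⊖ zero (suc n) = sym (+-identityˡ _)
  ⟦⟧-⊖ (suc m) (suc n) = begin
    ⟦ suc m ⊖ suc n ⟧                    ≡⟨ ≡.cong ⟦_⟧ (ℤ.[1+m]⊖[1+n]≡m⊖n m n) ⟩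
    ⟦ m ⊖ n ⟧                            ≈⟨ ⟦⟧-⊖ m n ⟩
    m · 1# - n · 1#                      ≈⟨ +-identityˡ _ ⟨
    0# + (m · 1# - n · 1#)               ≈⟨ +-congʳ (-‿inverseʳ 1#) ⟨
    1# - 1# + (m · 1# - n · 1#)          ≈⟨ +-assoc _ _ _ ⟩
    1# + (- 1# + (m · 1# - n · 1#))      ≈⟨ +-congˡ (+-assoc _ _ _) ⟨
    1# + ((- 1# + m · 1#) - n · 1#)      ≈⟨ +-congˡ (+-congʳ (+-comm _ _)) ⟩
    1# + ((m · 1# - 1#) - n · 1#)        ≈⟨ +-congˡ (+-assoc _ _ _) ⟩
    1# + (m · 1# + (- 1# - n · 1#))      ≈⟨ +-assoc _ _ _ ⟨
    (1# + m · 1#) + (- 1# - n · 1#)      ≈⟨ +-congˡ (⁻¹-∙-comm _ _) ⟩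
    (1# + m · 1#) - (1# + n · 1#)        ≈⟨ +-cong (1+× m 1#) (-‿cong (1+× n 1#)) ⟨
    suc m · 1# - suc n · 1#              ∎

  ⟦⟧-neg : ∀ i → ⟦ ℤ.- i ⟧ ≈ - ⟦ i ⟧
  ⟦⟧-neg (ℤ.+ zero)  = sym -0#≈0#
  ⟦⟧-neg (ℤ.+ suc n) = refl
  ⟦⟧-neg -[1+ n ]    = sym (-‿involutive _)

  ⟦⟧-+ : ∀ i j → ⟦ i ℤ.+ j ⟧ ≈ ⟦ i ⟧ + ⟦ j ⟧
  ⟦⟧-+ (ℤ.+ m)  (ℤ.+ n)  = ×-homo-+ 1# m n
  ⟦⟧-+ (ℤ.+ m)  -[1+ n ] = ⟦⟧-⊖ m (suc n)
  ⟦⟧-+ -[1+ m ] (ℤ.+ n)  = trans (⟦⟧-⊖ n (suc m)) (+-comm _ _)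
  ⟦⟧-+ -[1+ m ] -[1+ n ] = begin
    - (suc (suc (m ℕ.+ n)) · 1#)          ≡⟨ ≡.cong (λ k → - (k · 1#)) (ℕ.+-suc (suc m) n) ⟨
    - ((suc m ℕ.+ suc n) · 1#)            ≈⟨ -‿cong (×-homo-+ 1# (suc m) (suc n)) ⟩
    - (suc m · 1# + suc n · 1#)           ≈⟨ ⁻¹-∙-comm _ _ ⟨
    - (suc m · 1#) - suc n · 1#           ∎

  ⟦⟧-*₊ : ∀ m j → ⟦ ℤ.+ m ℤ.* j ⟧ ≈ m · 1# * ⟦ j ⟧
  ⟦⟧-*₊ m (ℤ.+ n) = begin
    ⟦ ℤ.+ m ℤ.* ℤ.+ n ⟧   ≡⟨ ≡.cong ⟦_⟧ (ℤ.pos-* m n) ⟨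
    (m ℕ.* n) · 1#        ≈⟨ ×1-homo-* m n ⟩
    m · 1# * n · 1#       ∎
  ⟦⟧-*₊ m -[1+ n ] = begin
    ⟦ ℤ.+ m ℤ.* ℤ.- (ℤ.+ suc n) ⟧      ≡⟨ ≡.cong ⟦_⟧ (ℤ.neg-distribʳ-* (ℤ.+ m) (ℤ.+ suc n)) ⟨
    ⟦ ℤ.- (ℤ.+ m ℤ.* ℤ.+ suc n) ⟧      ≈⟨ ⟦⟧-neg (ℤ.+ m ℤ.* ℤ.+ suc n) ⟩
    - ⟦ ℤ.+ m ℤ.* ℤ.+ suc n ⟧          ≈⟨ -‿cong (⟦⟧-*₊ m (ℤ.+ suc n)) ⟩
    - (m · 1# * suc n · 1#)            ≈⟨ -‿distribʳ-* _ _ ⟩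
    m · 1# * - (suc n · 1#)            ∎

  ⟦⟧-* : ∀ i j → ⟦ i ℤ.* j ⟧ ≈ ⟦ i ⟧ * ⟦ j ⟧
  ⟦⟧-* (ℤ.+ m)  j = ⟦⟧-*₊ m j
  ⟦⟧-* -[1+ m ] j = begin
    ⟦ ℤ.- (ℤ.+ suc m) ℤ.* j ⟧      ≡⟨ ≡.cong ⟦_⟧ (ℤ.neg-distribˡ-* (ℤ.+ suc m) j) ⟨
    ⟦ ℤ.- (ℤ.+ suc m ℤ.* j) ⟧      ≈⟨ ⟦⟧-neg (ℤ.+ suc m ℤ.* j) ⟩
    - ⟦ ℤ.+ suc m ℤ.* j ⟧          ≈⟨ -‿cong (⟦⟧-*₊ (suc m) j) ⟩
    - (suc m · 1# * ⟦ j ⟧)         ≈⟨ -‿distribˡ-* _ _ ⟩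
    - (suc m · 1#) * ⟦ j ⟧         ∎

  homomorphism : ℤ.+-*-rawRing -Raw-AlmostCommutative⟶ fromCommutativeRing R
  homomorphism = record
    { ⟦_⟧    = ⟦_⟧
    ; +-homo = ⟦⟧-+
    ; *-homo = ⟦⟧-*
    ; -‿homo = ⟦⟧-neg
    ; 0-homo = refl
    ; 1-homo = refl
    }

  open import Algebra.Solver.Ring ℤ.+-*-rawRing (fromCommutativeRing R) homomorphism
    (λ i j → Maybe.map (λ i≡j → reflexive (≡.cong ⟦_⟧ i≡j)) (dec⇒maybe (i ℤ.≟ j)))
    public using (solve; _:=_; _:+_; _:*_; _:-_; :-_; con; Polynomial)

-- Blocks and outer singletons

-- The combinatorial substitute for being isolated and visible from the additional point. It
-- mentions only which subsets are blocks, hence is insensitive to the list that presents them.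
Outer : ∀ {n} → (Subset n → Set) → Fin n → Set
Outer 𝓑 i = 𝓑 ⁅ i ⁆ × (∀ {B x y} → 𝓑 B → x ∈ B → y ∈ B → x Fin.< i → ¬ (i Fin.< y))

AllPairs-lookup : ∀ {a r} {A : Set a} {R : A → A → Set r} {xs x y} →
                  AllPairs R xs → x ∈ₗ xs → y ∈ₗ xs → x ≡ y ⊎ R x y ⊎ R y x
AllPairs-lookup (_ ∷ _)  (here ≡.refl) (here ≡.refl) = inj₁ ≡.refl
AllPairs-lookup (r ∷ _)  (here ≡.refl) (there y∈)  = inj₂ (inj₁ (All.lookup r y∈))
AllPairs-lookup (r ∷ _)  (there x∈)  (here ≡.refl) = inj₂ (inj₂ (All.lookup r x∈))
AllPairs-lookup (_ ∷ rs) (there x∈)  (there y∈)  = AllPairs-lookup rs x∈ y∈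

blocks-disjoint : ∀ {n} (P : Partition n) {B C i} → B ∈ₗ blocks P → C ∈ₗ blocks P →
                  i ∈ B → i ∈ C → B ≡ C
blocks-disjoint P B∈ C∈ i∈B i∈C with AllPairs-lookup (disjoint P) B∈ C∈
... | inj₁ B≡C             = B≡C
... | inj₂ (inj₁ B∩C-empty) = contradiction (_ , x∈p∩q⁺ (i∈B , i∈C)) B∩C-empty
... | inj₂ (inj₂ C∩B-empty) = contradiction (_ , x∈p∩q⁺ (i∈C , i∈B)) C∩B-empty

least : ∀ {n} {B : Subset n} → Nonempty B → ∃ λ x → x ∈ B × (∀ {z} → z ∈ B → x Fin.≤ z)
least {B = inside ∷ B} _ = zero , Vec.here , λ _ → z≤n
least {B = outside ∷ B} (suc i , Vec.there i∈B) with least (i , i∈B)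
... | x , x∈B , x≤ = suc x , Vec.there x∈B , λ { (Vec.there z∈B) → s≤s (x≤ z∈B) }

greatest : ∀ {n} {B : Subset n} → Nonempty B → ∃ λ y → y ∈ B × (∀ {z} → z ∈ B → z Fin.≤ y)
greatest {B = b ∷ B} ne with nonempty? B
greatest {B = b ∷ B} ne | yes ne′ with greatest ne′
... | y , y∈B , ≤y = suc y , Vec.there y∈B , λ { Vec.here → z≤n ; (Vec.there z∈B) → s≤s (≤y z∈B) }
greatest {B = b ∷ B} (zero  , Vec.here)      | no ¬ne =
  zero , Vec.here , λ { Vec.here → z≤n ; (Vec.there z∈B) → contradiction (_ , z∈B) ¬ne }
greatest {B = b ∷ B} (suc i , Vec.there i∈B) | no ¬ne = contradiction (i , i∈B) ¬ne

-- Visibility in the plane over an ordered field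

module Geometry {c ℓ₁ ℓ₂ ℓ₃} (F : OrderedField c ℓ₁ ℓ₂ ℓ₃) where
  open OrderedField F
  open Plane F
  open import Algebra.Apartness.Properties.HeytingCommutativeRing heytingCommutativeRing
    using (x-0≈x; 1#0; invertibleˡ⇒#)

  commutativeRing : CommutativeRing c ℓ₁
  commutativeRing = record { isCommutativeRing = isCommutativeRing }

  open IntegerCoefficients commutativeRing using (solve; _:=_; _:+_; _:*_; _:-_; :-_; con; Polynomial)
  open IsStrictPartialOrder isStrictPartialOrder using ()
    renaming (trans to <-trans; irrefl to <-irrefl; <-respʳ-≈ to <-respʳ; <-respˡ-≈ to <-respˡ)

  <-asym′ : ∀ {x} → 0# < x → ¬ (x < 0#)
  <-asym′ 0<x x<0 = <-irrefl refl (<-trans 0<x x<0)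

  +-pos : ∀ {x y} → 0# < x → 0# < y → 0# < x + y
  +-pos {x} {y} 0<x 0<y = <-trans 0<y (<-respˡ (+-identityˡ y) (+-monoˡ-< y 0<x))

  neg-pos : ∀ {x} → x < 0# → 0# < - x
  neg-pos {x} x<0 = <-respˡ (-‿inverseʳ x) (<-respʳ (+-identityˡ (- x)) (+-monoˡ-< (- x) x<0))

  pos-neg : ∀ {x} → 0# < - x → x < 0#
  pos-neg {x} 0<-x = <-respˡ (+-identityˡ x) (<-respʳ (-‿inverseˡ x) (+-monoˡ-< x 0<-x))

  pos-diff : ∀ {x y} → 0# < y - x → x < y
  pos-diff {x} {y} 0<y-x = <-respˡ (+-identityˡ x)
    (<-respʳ (solve 2 (λ x y → y :- x :+ x := y) refl x y) (+-monoˡ-< x 0<y-x))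

  0<1 : 0# < 1#
  0<1 with #⇒<⊎> 1#0
  ... | inj₂ 0<1 = 0<1
  -- If 1 were negative, 1 = (-1)(-1) would be positive.
  ... | inj₁ 1<0 = contradiction 1<0 (<-asym′ (<-respʳ
    (solve 0 (:- con 1ℤ :* :- con 1ℤ := con 1ℤ) refl) (*-pos (neg-pos 1<0) (neg-pos 1<0))))

  #0⇒inverse : ∀ {x} → x # 0# → ∃ λ u → u * x ≈ 1#
  #0⇒inverse {x} x#0 with #⇒invertible x#0
  ... | u , ux≈1 , _ = u , trans (*-congˡ (sym (x-0≈x x))) ux≈1

  inverse⇒#0 : ∀ {u x} → u * x ≈ 1# → x # 0#
  inverse⇒#0 {u} {x} ux≈1 = invertibleˡ⇒# (u , trans (*-congˡ (x-0≈x x)) ux≈1)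

  -- Only elements apart from 0 are known to be positive or negative, so x must first be shown to be
  -- apart from 0: an inverse of `x * y`, multiplied by y, is an inverse of x.
  *-cancelʳ-pos : ∀ {x y} → 0# < y → 0# < x * y → 0# < x
  *-cancelʳ-pos {x} {y} 0<y 0<xy with #0⇒inverse (#-sym (<⇒# 0<xy))
  ... | u , uxy≈1 with #⇒<⊎> (inverse⇒#0 {u * y} {x} (trans (solve 3 (λ u x y → u :* y :* x := u :* (x :* y)) refl u x y) uxy≈1))
  ...   | inj₂ 0<x = 0<x
  ...   | inj₁ x<0 = contradiction (*-pos (neg-pos x<0) 0<y) λ 0<-xy →
    <-irrefl refl (<-trans 0<xy (pos-neg (<-respʳ (solve 2 (λ x y → :- x :* y := :- (x :* y)) refl x y) 0<-xy)))

  pos-inverse : ∀ {x} → 0# < x → ∃ λ u → u * x ≈ 1# × 0# < u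
  pos-inverse 0<x with #0⇒inverse (#-sym (<⇒# 0<x))
  ... | u , ux≈1 = u , ux≈1 , *-cancelʳ-pos 0<x (<-respʳ (sym ux≈1) 0<1)

  -- The signs of the weights cannot be decided, but 0 and 1 are apart, so by cotransitivity t is
  -- apart from one of them. Thus one weight is positive, and the equation would make the other one
  -- negative.
  convex-combination≉0 : ∀ {a b t} → 0# < a → 0# < b → 0# ≤ t → t ≤ 1# →
                         ¬ ((1# - t) * a + t * b ≈ 0#)
  convex-combination≉0 {a} {b} {t} 0<a 0<b 0≤t t≤1 eq with #-cotrans (#-sym 1#0) t
  ... | inj₁ 0#t with #⇒<⊎> 0#t
  ...   | inj₂ t<0 = 0≤t t<0
  ...   | inj₁ 0<t = t≤1 (pos-diff (*-cancelʳ-pos 0<a (<-respʳ tb≈ (*-pos 0<t 0<b))))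
    where
    tb≈ : t * b ≈ (t - 1#) * a
    tb≈ = trans (solve 3 (λ a b t → t :* b := ((con 1ℤ :- t) :* a :+ t :* b) :+ (t :- con 1ℤ) :* a) refl a b t)
                (trans (+-congʳ eq) (+-identityˡ _))
  convex-combination≉0 {a} {b} {t} 0<a 0<b 0≤t t≤1 eq | inj₂ t#1 with #⇒<⊎> t#1
  ...   | inj₂ 1<t = t≤1 1<t
  ...   | inj₁ t<1 = 0≤t (pos-neg (*-cancelʳ-pos 0<b (<-respʳ ≈-tb (*-pos 0<1-t 0<a))))
    where
    0<1-t : 0# < 1# - t
    0<1-t = <-respˡ (-‿inverseʳ t) (+-monoˡ-< (- t) t<1)
    ≈-tb : (1# - t) * a ≈ - t * b
    ≈-tb = trans (solve 3 (λ a b t → (con 1ℤ :- t) :* a := ((con 1ℤ :- t) :* a :+ t :* b) :+ :- t :* b) refl a b t)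
                 (trans (+-congʳ eq) (+-identityˡ _))

  orient-cyclic : ∀ u v w → orient u v w ≈ orient v w u
  orient-cyclic (u₁ , u₂) (v₁ , v₂) (w₁ , w₂) = solve 6 (λ u₁ u₂ v₁ v₂ w₁ w₂ →
    (v₁ :- u₁) :* (w₂ :- u₂) :- (v₂ :- u₂) :* (w₁ :- u₁) :=
    (w₁ :- v₁) :* (u₂ :- v₂) :- (w₂ :- v₂) :* (u₁ :- v₁)) refl u₁ u₂ v₁ v₂ w₁ w₂

  orient-congʳ : ∀ u v {w w′} → w ≋ w′ → orient u v w ≈ orient u v w′
  orient-congʳ u v (eq₁ , eq₂) = +-cong (*-congˡ (+-congʳ eq₂)) (-‿cong (*-congˡ (+-congʳ eq₁)))

  orient-lerp : ∀ u v a b t →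
    orient u v (lerp t a b) ≈ (1# - t) * orient u v a + t * orient u v b
  orient-lerp (u₁ , u₂) (v₁ , v₂) (a₁ , a₂) (b₁ , b₂) t =
    solve 9 (λ u₁ u₂ v₁ v₂ a₁ a₂ b₁ b₂ t →
      (v₁ :- u₁) :* (((con 1ℤ :- t) :* a₂ :+ t :* b₂) :- u₂) :-
      (v₂ :- u₂) :* (((con 1ℤ :- t) :* a₁ :+ t :* b₁) :- u₁) :=
      (con 1ℤ :- t) :* ((v₁ :- u₁) :* (a₂ :- u₂) :- (v₂ :- u₂) :* (a₁ :- u₁)) :+
      t :* ((v₁ :- u₁) :* (b₂ :- u₂) :- (v₂ :- u₂) :* (b₁ :- u₁)))
      refl u₁ u₂ v₁ v₂ a₁ a₂ b₁ b₂ t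

  orient-on-line : ∀ u v t → orient u v (lerp t u v) ≈ 0#
  orient-on-line (u₁ , u₂) (v₁ , v₂) t = solve 5 (λ u₁ u₂ v₁ v₂ t →
      (v₁ :- u₁) :* (((con 1ℤ :- t) :* u₂ :+ t :* v₂) :- u₂) :-
      (v₂ :- u₂) :* (((con 1ℤ :- t) :* u₁ :+ t :* v₁) :- u₁) := con 0ℤ)
      refl u₁ u₂ v₁ v₂ t

  -- `orient u v` is affine in its third argument and vanishes on the line through u and v; along
  -- the segment from a to b it is a convex combination of two positive values.
  same-side⇒disjoint : ∀ {u v a b z} → 0# < orient u v a → 0# < orient u v b →
                       OnSegment a b z → ¬ InsideSegment u v z
  same-side⇒disjoint {u} {v} {a} {b} 0<a 0<b (t , 0≤t , t≤1 , z≋) (s , _ , _ , z≋′) =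
    convex-combination≉0 0<a 0<b 0≤t t≤1
      (trans (sym (orient-lerp u v a b t))
      (trans (sym (orient-congʳ u v z≋))
      (trans (orient-congʳ u v z≋′) (orient-on-line u v s))))

  -- Both sides are the doubled area of the quadrilateral x i y q, cut along either diagonal.
  orient-additive : ∀ x i y q → orient x i q + orient i y q ≈ orient x i y + orient x y q
  orient-additive (x₁ , x₂) (i₁ , i₂) (y₁ , y₂) (q₁ , q₂) =
    solve 8 (λ x₁ x₂ i₁ i₂ y₁ y₂ q₁ q₂ →
      ((i₁ :- x₁) :* (q₂ :- x₂) :- (i₂ :- x₂) :* (q₁ :- x₁)) :+
      ((y₁ :- i₁) :* (q₂ :- i₂) :- (y₂ :- i₂) :* (q₁ :- i₁)) :=
      ((i₁ :- x₁) :* (y₂ :- x₂) :- (i₂ :- x₂) :* (y₁ :- x₁)) :+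
      ((y₁ :- x₁) :* (q₂ :- x₂) :- (y₂ :- x₂) :* (q₁ :- x₁)))
      refl x₁ x₂ i₁ i₂ y₁ y₂ q₁ q₂

  -- With `cramer₂`, the linear relation between three vectors of the plane, whose coefficients are
  -- the determinants of the pairs. For the vectors from x to i, y and q it is the hypothesis of
  -- `meet` on the ratio.
  cramer₁ : ∀ a₁ a₂ b₁ b₂ c₁ c₂ →
    (b₁ * c₂ - b₂ * c₁) * a₁ + (a₁ * b₂ - a₂ * b₁) * c₁ ≈ (a₁ * c₂ - a₂ * c₁) * b₁
  cramer₁ = solve 6 (λ a₁ a₂ b₁ b₂ c₁ c₂ →
    (b₁ :* c₂ :- b₂ :* c₁) :* a₁ :+ (a₁ :* b₂ :- a₂ :* b₁) :* c₁ :=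
    (a₁ :* c₂ :- a₂ :* c₁) :* b₁) refl

  cramer₂ : ∀ a₁ a₂ b₁ b₂ c₁ c₂ →
    (b₁ * c₂ - b₂ * c₁) * a₂ + (a₁ * b₂ - a₂ * b₁) * c₂ ≈ (a₁ * c₂ - a₂ * c₁) * b₂
  cramer₂ = solve 6 (λ a₁ a₂ b₁ b₂ c₁ c₂ →
    (b₁ :* c₂ :- b₂ :* c₁) :* a₂ :+ (a₁ :* b₂ :- a₂ :* b₁) :* c₂ :=
    (a₁ :* c₂ :- a₂ :* c₁) :* b₂) refl

  -- With w the inverse of the area of the quadrilateral, the
  -- diagonals cut each other in the ratio of the areas of the opposite triangles.
  meet : ∀ {w α β γ δ} i q x y → w * β ≈ 1# - w * α → w * δ ≈ 1# - w * γ → γ + δ ≈ α + β →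
         β * (i - x) + α * (q - x) ≈ γ * (y - x) →
         (1# - w * α) * i + w * α * q ≈ (1# - w * γ) * x + w * γ * y
  meet {w} {α} {β} {γ} {δ} i q x y wβ wδ area ratio = begin
    (1# - w * α) * i + w * α * q
      ≈⟨ +-congʳ (*-congʳ wβ) ⟨
    w * β * i + w * α * q
      ≈⟨ solve 6 (λ w α β i q x → w :* β :* i :+ w :* α :* q :=
           w :* ((β :* (i :- x) :+ α :* (q :- x)) :+ (α :+ β) :* x)) refl w α β i q x ⟩
    w * ((β * (i - x) + α * (q - x)) + (α + β) * x)
      ≈⟨ *-congˡ (+-cong ratio (*-congʳ (sym area))) ⟩
    w * (γ * (y - x) + (γ + δ) * x)
      ≈⟨ solve 5 (λ w γ δ x y → w :* (γ :* (y :- x) :+ (γ :+ δ) :* x) :=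
           w :* δ :* x :+ w :* γ :* y) refl w γ δ x y ⟩
    w * δ * x + w * γ * y
      ≈⟨ +-congʳ (*-congʳ wδ) ⟩
    (1# - w * γ) * x + w * γ * y ∎
    where open import Relation.Binary.Reasoning.Setoid setoid

  complement : ∀ {w a b} → w * (a + b) ≈ 1# → w * b ≈ 1# - w * a
  complement {w} {a} {b} w[a+b]≈1 = trans
    (solve 3 (λ w a b → w :* b := w :* (a :+ b) :- w :* a) refl w a b) (+-congʳ w[a+b]≈1)

  diagonals-cross : ∀ x i y q →
    0# < orient x i y → 0# < orient x y q → 0# < orient x i q → 0# < orient i y q →
    ∃ λ z → OnSegment i q z × InsideSegment x y z
  diagonals-cross x i y q 0<α 0<β 0<γ 0<δ =
    let w , w[α+β]≈1 , 0<w = pos-inverse (+-pos 0<α 0<β)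
        area = orient-additive x i y q
        wβ = complement w[α+β]≈1
        wδ = complement (trans (*-congˡ area) w[α+β]≈1)
        1≮wα = λ 1<wα → <-irrefl refl (<-trans 1<wα (pos-diff (<-respʳ wβ (*-pos 0<w 0<β))))
        a₁ = proj₁ i - proj₁ x ; a₂ = proj₂ i - proj₂ x
        b₁ = proj₁ y - proj₁ x ; b₂ = proj₂ y - proj₂ x
        c₁ = proj₁ q - proj₁ x ; c₂ = proj₂ q - proj₂ x
    in lerp (w * orient x i y) i q ,
       (w * orient x i y , <-asym′ (*-pos 0<w 0<α) , 1≮wα , refl , refl) ,
       (w * orient x i q , *-pos 0<w 0<γ , pos-diff (<-respʳ wδ (*-pos 0<w 0<δ)) ,
         meet (proj₁ i) (proj₁ q) (proj₁ x) (proj₁ y) wβ wδ area (cramer₁ a₁ a₂ b₁ b₂ c₁ c₂) ,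
         meet (proj₂ i) (proj₂ q) (proj₂ x) (proj₂ y) wβ wδ area (cramer₂ a₁ a₂ b₁ b₂ c₁ c₂))

  module _ {n} (p : Fin (suc n) → Point) (convex : Convex p) where

    root : Point
    root = p (fromℕ n)

    vertex : Fin n → Point
    vertex i = p (inject₁ i)

    left-turn : ∀ {i j k} → i Fin.< j → j Fin.< k → 0# < orient (vertex i) (vertex j) (vertex k)
    left-turn {i} {j} {k} i<j j<k = convex
      (≡.subst₂ ℕ._<_ (≡.sym (Fin.toℕ-inject₁ i)) (≡.sym (Fin.toℕ-inject₁ j)) i<j)
      (≡.subst₂ ℕ._<_ (≡.sym (Fin.toℕ-inject₁ j)) (≡.sym (Fin.toℕ-inject₁ k)) j<k)

    left-turn-root : ∀ {i j} → i Fin.< j → 0# < orient (vertex i) (vertex j) root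
    left-turn-root {i} {j} i<j = convex
      (≡.subst₂ ℕ._<_ (≡.sym (Fin.toℕ-inject₁ i)) (≡.sym (Fin.toℕ-inject₁ j)) i<j)
      (≡.subst₂ ℕ._<_ (≡.sym (Fin.toℕ-inject₁ j)) (≡.sym (Fin.toℕ-fromℕ n)) (Fin.toℕ<n j))

    visible⇒outer : ∀ (P : Partition n) {i} → Isolated P i →
                    Visible P vertex (vertex i) root → Outer (_∈ₗ blocks P) i
    visible⇒outer P {i} isolated visible = isolated , λ {B} {x₀} {y₀} B∈ x₀∈B y₀∈B x₀<i i<y₀ →
      let x , x∈B , x≤ = least (x₀ , x₀∈B)
          y , y∈B , ≤y = greatest (x₀ , x₀∈B)
          x<i = ℕ.≤-<-trans (x≤ x₀∈B) x₀<i
          i<y = ℕ.<-≤-trans i<y₀ (≤y y₀∈B)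
          x<y = ℕ.<-trans x<i i<y
          z , onSegment , insideSegment = diagonals-cross (vertex x) (vertex i) (vertex y) root
            (left-turn x<i i<y) (left-turn-root x<y) (left-turn-root x<i) (left-turn-root i<y)
      in visible (x , y , (x<y , B , B∈ , x∈B , y∈B , inj₂ (λ z∈B → x≤ z∈B , ≤y z∈B)) ,
                  z , onSegment , insideSegment)

    -- Both ends of an edge lie on one side of i, and then by convexity i and the additional point
    -- are on the same side of the line through the edge. An edge ending at i would belong to the
    -- block `⁅ i ⁆`, although its ends are distinct.
    outer⇒visible : ∀ (P : Partition n) {i} → Outer (_∈ₗ blocks P) i →
                    Visible P vertex (vertex i) root
    outer⇒visible P {i} (isolated , uncovered) (x , y , (x<y , B , B∈ , x∈B , y∈B , _) , z , onSegment , insideSegment)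
      with Fin.<-cmp x i | Fin.<-cmp y i
    ... | tri< x<i _ _ | tri> _ _ i<y = uncovered B∈ x∈B y∈B x<i i<y
    ... | tri> _ _ i<x | _ = same-side⇒disjoint
      (<-respʳ (orient-cyclic (vertex i) (vertex x) (vertex y)) (left-turn i<x x<y))
      (left-turn-root x<y) onSegment insideSegment
    ... | _ | tri< y<i _ _ = same-side⇒disjoint
      (left-turn x<y y<i) (left-turn-root x<y) onSegment insideSegment
    ... | tri≈ _ ≡.refl _ | _ with blocks-disjoint P isolated B∈ (x∈⁅x⁆ i) x∈B
    ...   | ≡.refl = Fin.<-irrefl (≡.sym (x∈⁅y⁆⇒x≡y i y∈B)) x<y
    outer⇒visible P {i} (isolated , uncovered) (x , y , (x<y , B , B∈ , x∈B , y∈B , _) , z , onSegment , insideSegment)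
      | tri< _ _ _ | tri≈ _ ≡.refl _ with blocks-disjoint P isolated B∈ (x∈⁅x⁆ i) y∈B
    ...   | ≡.refl = Fin.<-irrefl (x∈⁅y⁆⇒x≡y i x∈B) x<y

-- Adding and removing the first vertex

open ≡ using (refl; sym; trans; cong; cong₂; subst; subst₂)

-- Blocks are given by a predicate, because partitions are compared by their sets of blocks and
-- because `Shatter` yields no list.
record IsNonCrossingPartition {n} (𝓑 : Subset n → Set) : Set where
  field
    inhabited   : ∀ {B} → 𝓑 B → Nonempty B
    unique      : ∀ {B C i} → 𝓑 B → 𝓑 C → i ∈ B → i ∈ C → B ≡ C
    total       : ∀ i → ∃ λ B → 𝓑 B × i ∈ B
    noncrossing : ∀ {a b c d B C} → a Fin.< b → b Fin.< c → c Fin.< d →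
                  𝓑 B → 𝓑 C → a ∈ B → c ∈ B → b ∈ C → d ∈ C → B ≡ C

isNonCrossingPartition : ∀ {n} (P : Partition n) → NonCrossing P → IsNonCrossingPartition (_∈ₗ blocks P)
isNonCrossingPartition P nc = record
  { inhabited   = All.lookup (nonempty P)
  ; unique      = blocks-disjoint P
  ; total       = λ i → find (covers P i)
  ; noncrossing = nc
  }

open IsNonCrossingPartition

-- A new point in front of all others is joined to the points of T; the blocks
-- which meet T (in the applications, singletons) disappear.
Extend : ∀ {n} → Subset n → (Subset n → Set) → Subset (suc n) → Set
Extend T 𝓑 (inside  ∷ B) = B ≡ T
Extend T 𝓑 (outside ∷ B) = 𝓑 B × Empty (B ∩ T)

Shatter : ∀ {n} → Subset n → (Subset (suc n) → Set) → Subset n → Set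
Shatter T 𝓑 B = 𝓑 (outside ∷ B) ⊎ (∃ λ t → t ∈ T × B ≡ ⁅ t ⁆)

Singletons : ∀ {n} → (Subset n → Set) → Subset n → Set
Singletons 𝓑 S = ∀ i → i ∈ S ⇔ Outer 𝓑 i

singletons-unique : ∀ {n} {𝓑 𝓒 : Subset n → Set} {S T} → (∀ B → 𝓑 B ⇔ 𝓒 B) →
                    Singletons 𝓑 S → Singletons 𝓒 T → S ≡ T
singletons-unique 𝓑⇔𝓒 S-outer T-outer = ⊆-antisym
  (λ {i} i∈S → let single , uncovered = to (S-outer i) i∈S in
    from (T-outer i) (to (𝓑⇔𝓒 _) single , uncovered ∘ from (𝓑⇔𝓒 _)))
  (λ {i} i∈T → let single , uncovered = to (T-outer i) i∈T in
    from (S-outer i) (from (𝓑⇔𝓒 _) single , uncovered ∘ to (𝓑⇔𝓒 _)))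

extend-outer-zero : ∀ {n} {𝓑 : Subset n → Set} {T} → Outer (Extend T 𝓑) zero ⇔ T ≡ ⊥
extend-outer-zero = mk⇔ (sym ∘ proj₁) (λ T≡⊥ → sym T≡⊥ , λ { _ _ _ () })

module _ {n} {𝓑 : Subset n → Set} {S T : Subset n} (𝓑-nc : IsNonCrossingPartition 𝓑)
         (S-outer : Singletons 𝓑 S) (T⊆S : T ⊆ S) where

  meets⇒singleton : ∀ {B t} → 𝓑 B → t ∈ B → t ∈ T → B ≡ ⁅ t ⁆
  meets⇒singleton {t = t} B∈ t∈B t∈T =
    unique 𝓑-nc B∈ (proj₁ (to (S-outer t) (T⊆S t∈T))) t∈B (x∈⁅x⁆ t)

  extend-disjoint : ∀ {B} → 𝓑 B → Empty (B ∩ T) ⊎ ∃ λ t → t ∈ T × B ≡ ⁅ t ⁆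
  extend-disjoint {B} B∈ with nonempty? (B ∩ T)
  ... | no  empty       = inj₁ empty
  ... | yes (t , t∈B∩T) = let t∈B , t∈T = x∈p∩q⁻ B T t∈B∩T in
    inj₂ (t , t∈T , meets⇒singleton B∈ t∈B t∈T)

  extend-total : ∀ i → ∃ λ B → Extend T 𝓑 B × i ∈ B
  extend-total zero = inside ∷ T , refl , Vec.here
  extend-total (suc i) with total 𝓑-nc i
  ... | B , B∈ , i∈B with extend-disjoint B∈
  ...   | inj₁ empty = outside ∷ B , (B∈ , empty) , Vec.there i∈B
  ...   | inj₂ (t , t∈T , refl) with x∈⁅y⁆⇒x≡y t i∈B
  ...     | refl = inside ∷ T , refl , Vec.there t∈T

  -- If the new block crossed an old one, the old block would have elements on both sides of a
  -- member of T, which is outer.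
  extend-noncrossing : ∀ {a b c d B C} → a Fin.< b → b Fin.< c → c Fin.< d →
    Extend T 𝓑 B → Extend T 𝓑 C → a ∈ B → c ∈ B → b ∈ C → d ∈ C → B ≡ C
  extend-noncrossing {B = inside ∷ _} {C = inside ∷ _} _ _ _ refl refl _ _ _ _ = refl
  extend-noncrossing {B = inside ∷ _} {C = outside ∷ _} _ (s≤s b<c) (s≤s c<d) refl (C∈ , _)
    _ (Vec.there c∈T) (Vec.there b∈C) (Vec.there d∈C) =
    ⊥-elim (proj₂ (to (S-outer _) (T⊆S c∈T)) C∈ b∈C d∈C b<c c<d)
  extend-noncrossing {B = outside ∷ _} {C = inside ∷ _} (s≤s a<b) (s≤s b<c) _ (B∈ , _) refl
    (Vec.there a∈B) (Vec.there c∈B) (Vec.there b∈T) _ =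
    ⊥-elim (proj₂ (to (S-outer _) (T⊆S b∈T)) B∈ a∈B c∈B a<b b<c)
  extend-noncrossing {B = outside ∷ _} {C = outside ∷ _} (s≤s a<b) (s≤s b<c) (s≤s c<d) (B∈ , _) (C∈ , _)
    (Vec.there a∈B) (Vec.there c∈B) (Vec.there b∈C) (Vec.there d∈C) =
    cong (outside ∷_) (noncrossing 𝓑-nc a<b b<c c<d B∈ C∈ a∈B c∈B b∈C d∈C)

  -- The new block reaches from the first vertex to the greatest element of T: it absorbs the
  -- members of T and covers all other vertices before that element.
  extend-outer-suc : ∀ i → Outer (Extend T 𝓑) (suc i) ⇔ (i ∈ S × (∀ {t} → t ∈ T → t Fin.< i))
  extend-outer-suc i = mk⇔ ⇒ ⇐
    where
    ⇒ : Outer (Extend T 𝓑) (suc i) → i ∈ S × (∀ {t} → t ∈ T → t Fin.< i)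
    ⇒ ((single , disjoint′) , uncovered) = from (S-outer i) (single , uncovered′) , below
      where
      uncovered′ : ∀ {B x y} → 𝓑 B → x ∈ B → y ∈ B → x Fin.< i → ¬ (i Fin.< y)
      uncovered′ B∈ x∈B y∈B x<i i<y with extend-disjoint B∈
      ... | inj₁ empty = uncovered {outside ∷ _} (B∈ , empty) (Vec.there x∈B) (Vec.there y∈B) (s≤s x<i) (s≤s i<y)
      ... | inj₂ (t , _ , refl) with x∈⁅y⁆⇒x≡y t x∈B | x∈⁅y⁆⇒x≡y t y∈B
      ...   | refl | refl = Fin.<-asym x<i i<y
      below : ∀ {t} → t ∈ T → t Fin.< i
      below {t} t∈T = ℕ.≤∧≢⇒< (ℕ.≮⇒≥ λ i<t → uncovered {inside ∷ T} refl Vec.here (Vec.there t∈T) (s≤s z≤n) (s≤s i<t))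
        λ t≡i → disjoint′ (i , x∈p∩q⁺ (x∈⁅x⁆ i , subst (_∈ T) (Fin.toℕ-injective t≡i) t∈T))
    ⇐ : i ∈ S × (∀ {t} → t ∈ T → t Fin.< i) → Outer (Extend T 𝓑) (suc i)
    ⇐ (i∈S , below) = (proj₁ (to (S-outer i) i∈S) , disjoint′) , uncovered
      where
      disjoint′ : Empty (⁅ i ⁆ ∩ T)
      disjoint′ (t , t∈) with x∈p∩q⁻ ⁅ i ⁆ T t∈
      ... | t∈⁅i⁆ , t∈T = Fin.<-irrefl (x∈⁅y⁆⇒x≡y i t∈⁅i⁆) (below t∈T)
      uncovered : ∀ {B x y} → Extend T 𝓑 B → x ∈ B → y ∈ B → x Fin.< suc i → ¬ (suc i Fin.< y)
      uncovered {inside ∷ _} refl _ (Vec.there y∈T) _ (s≤s i<y) = Fin.<-asym i<y (below y∈T)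
      uncovered {outside ∷ _} (B∈ , _) (Vec.there x∈B) (Vec.there y∈B) (s≤s x<i) (s≤s i<y) =
        proj₂ (to (S-outer i) i∈S) B∈ x∈B y∈B x<i i<y

  shatter-extend : ∀ B → 𝓑 B ⇔ Shatter T (Extend T 𝓑) B
  shatter-extend B = mk⇔ ⇒ ⇐
    where
    ⇒ : 𝓑 B → Shatter T (Extend T 𝓑) B
    ⇒ B∈ with extend-disjoint B∈
    ... | inj₁ empty  = inj₁ (B∈ , empty)
    ... | inj₂ single = inj₂ single
    ⇐ : Shatter T (Extend T 𝓑) B → 𝓑 B
    ⇐ (inj₁ (B∈ , _))         = B∈
    ⇐ (inj₂ (t , t∈T , refl)) = proj₁ (to (S-outer t) (T⊆S t∈T))

module _ {n} {𝓑 : Subset (suc n) → Set} {T : Subset n} (𝓑-nc : IsNonCrossingPartition 𝓑)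
         (T∈ : 𝓑 (inside ∷ T)) where

  ∉T : ∀ {B i} → 𝓑 (outside ∷ B) → i ∈ B → i ∉ T
  ∉T B∈ i∈B i∈T with unique 𝓑-nc B∈ T∈ (Vec.there i∈B) (Vec.there i∈T)
  ... | ()

  shatter-nc : IsNonCrossingPartition (Shatter T 𝓑)
  shatter-nc = record
    { inhabited   = inhabited′
    ; unique      = unique′
    ; total       = total′
    ; noncrossing = noncrossing′
    }
    where
    inhabited′ : ∀ {B} → Shatter T 𝓑 B → Nonempty B
    inhabited′ (inj₁ B∈) with inhabited 𝓑-nc B∈
    ... | suc i , Vec.there i∈B = i , i∈B
    inhabited′ (inj₂ (t , _ , refl)) = t , x∈⁅x⁆ t
    unique′ : ∀ {B C i} → Shatter T 𝓑 B → Shatter T 𝓑 C → i ∈ B → i ∈ C → B ≡ C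
    unique′ (inj₁ B∈) (inj₁ C∈) i∈B i∈C = ∷-injectiveʳ (unique 𝓑-nc B∈ C∈ (Vec.there i∈B) (Vec.there i∈C))
    unique′ (inj₁ B∈) (inj₂ (t , t∈T , refl)) i∈B i∈C with x∈⁅y⁆⇒x≡y t i∈C
    ... | refl = contradiction t∈T (∉T B∈ i∈B)
    unique′ (inj₂ (t , t∈T , refl)) (inj₁ C∈) i∈B i∈C with x∈⁅y⁆⇒x≡y t i∈B
    ... | refl = contradiction t∈T (∉T C∈ i∈C)
    unique′ (inj₂ (t , _ , refl)) (inj₂ (u , _ , refl)) i∈B i∈C with x∈⁅y⁆⇒x≡y t i∈B | x∈⁅y⁆⇒x≡y u i∈C
    ... | refl | refl = refl
    total′ : ∀ i → ∃ λ B → Shatter T 𝓑 B × i ∈ B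
    total′ i with total 𝓑-nc (suc i)
    ... | outside ∷ B , B∈ , Vec.there i∈B = B , inj₁ B∈ , i∈B
    ... | inside  ∷ B , B∈ , Vec.there i∈B with unique 𝓑-nc B∈ T∈ Vec.here Vec.here
    ...   | refl = ⁅ i ⁆ , inj₂ (i , i∈B , refl) , x∈⁅x⁆ i
    noncrossing′ : ∀ {a b c d B C} → a Fin.< b → b Fin.< c → c Fin.< d →
      Shatter T 𝓑 B → Shatter T 𝓑 C → a ∈ B → c ∈ B → b ∈ C → d ∈ C → B ≡ C
    noncrossing′ a<b b<c c<d (inj₁ B∈) (inj₁ C∈) a∈B c∈B b∈C d∈C = ∷-injectiveʳ
      (noncrossing 𝓑-nc (s≤s a<b) (s≤s b<c) (s≤s c<d) B∈ C∈
        (Vec.there a∈B) (Vec.there c∈B) (Vec.there b∈C) (Vec.there d∈C))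
    noncrossing′ a<b b<c c<d (inj₂ (t , _ , refl)) _ a∈B c∈B _ _ with x∈⁅y⁆⇒x≡y t a∈B | x∈⁅y⁆⇒x≡y t c∈B
    ... | refl | refl = contradiction a<b (Fin.<-asym b<c)
    noncrossing′ a<b b<c c<d _ (inj₂ (t , _ , refl)) _ _ b∈C d∈C with x∈⁅y⁆⇒x≡y t b∈C | x∈⁅y⁆⇒x≡y t d∈C
    ... | refl | refl = contradiction b<c (Fin.<-asym c<d)

  -- A block of the shattered partition around t ∈ T would cross the block of zero.
  shatter-outer : ∀ {t} → t ∈ T → Outer (Shatter T 𝓑) t
  shatter-outer {t} t∈T = inj₂ (t , t∈T , refl) , uncovered
    where
    uncovered : ∀ {B x y} → Shatter T 𝓑 B → x ∈ B → y ∈ B → x Fin.< t → ¬ (t Fin.< y)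
    uncovered (inj₁ B∈) x∈B y∈B x<t t<y
      with noncrossing 𝓑-nc (s≤s z≤n) (s≤s x<t) (s≤s t<y) T∈ B∈ Vec.here (Vec.there t∈T) (Vec.there x∈B) (Vec.there y∈B)
    ... | ()
    uncovered (inj₂ (u , _ , refl)) x∈B y∈B x<t t<y with x∈⁅y⁆⇒x≡y u x∈B | x∈⁅y⁆⇒x≡y u y∈B
    ... | refl | refl = Fin.<-asym x<t t<y

  -- Together with `shatter-extend` this makes the recursion on the vertices bijective: the present
  -- half gives `code-surjective`, the other one `code-injective`.
  extend-shatter : ∀ B → 𝓑 B ⇔ Extend T (Shatter T 𝓑) B
  extend-shatter (inside ∷ B) = mk⇔
    (λ B∈ → ∷-injectiveʳ (unique 𝓑-nc B∈ T∈ Vec.here Vec.here))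
    (λ { refl → T∈ })
  extend-shatter (outside ∷ B) = mk⇔
    (λ B∈ → inj₁ B∈ , λ { (i , i∈) → let i∈B , i∈T = x∈p∩q⁻ B T i∈ in ∉T B∈ i∈B i∈T })
    λ { (inj₁ B∈ , _) → B∈
      ; (inj₂ (t , t∈T , refl) , empty) → contradiction (t , x∈p∩q⁺ (x∈⁅x⁆ t , t∈T)) empty }

-- Choosing the outer singletons to be joined

-- A nonempty selection among D items of which the last e come after the
-- greatest selected one; in Choice the selection may be empty, and the new point
-- then counts as a further item.
data Selection : ℕ → ℕ → Set where
  last : ∀ {d} → Selection (suc d) d
  more : ∀ {d e} → Bool → Selection d e → Selection (suc d) e

data Choice : ℕ → ℕ → Set where
  none : ∀ {d} → Choice d (suc d)
  some : ∀ {d e} → Selection d e → Choice d e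

-- The index d is meant to be `∣ S ∣`; this equation is a separate hypothesis of the lemmas, so that
-- d can be an index of `Code`. Under it the clause for `[]` is never reached, since `Selection 0 e`
-- is empty.
selected : ∀ {n d e} → Subset n → Selection d e → Subset n
selected []            _          = []
selected (outside ∷ S) x          = outside ∷ selected S x
selected (inside  ∷ S) last       = inside ∷ ⊥
selected (inside  ∷ S) (more b x) = b ∷ selected S x

remaining : ∀ {n d e} → Subset n → Selection d e → Subset n
remaining []            _          = []
remaining (outside ∷ S) x          = outside ∷ remaining S x
remaining (inside  ∷ S) last       = outside ∷ S
remaining (inside  ∷ S) (more b x) = outside ∷ remaining S x

chosen : ∀ {n d e} → Subset n → Choice d e → Subset n
chosen S none     = ⊥
chosen S (some x) = selected S x

survivors : ∀ {n d e} → Subset n → Choice d e → Subset (suc n)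
survivors S none     = inside ∷ S
survivors S (some x) = outside ∷ remaining S x

selected⊆ : ∀ {n d e} (S : Subset n) (x : Selection d e) → selected S x ⊆ S
selected⊆ (outside ∷ S) x             (Vec.there i∈) = Vec.there (selected⊆ S x i∈)
selected⊆ (inside  ∷ S) last          Vec.here       = Vec.here
selected⊆ (inside  ∷ S) last          (Vec.there i∈) = contradiction i∈ ∉⊥
selected⊆ (inside  ∷ S) (more true x) Vec.here       = Vec.here
selected⊆ (inside  ∷ S) (more b x)    (Vec.there i∈) = Vec.there (selected⊆ S x i∈)

chosen⊆ : ∀ {n d e} (S : Subset n) (x : Choice d e) → chosen S x ⊆ S
chosen⊆ S none     i∈⊥ = contradiction i∈⊥ ∉⊥
chosen⊆ S (some x) = selected⊆ S x

selected-nonempty : ∀ {n d e} (S : Subset n) (x : Selection d e) → ∣ S ∣ ≡ d → Nonempty (selected S x)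
selected-nonempty []            last       ()
selected-nonempty []            (more _ _) ()
selected-nonempty (outside ∷ S) x          eq = let i , i∈ = selected-nonempty S x eq in suc i , Vec.there i∈
selected-nonempty (inside  ∷ S) last       eq = zero , Vec.here
selected-nonempty (inside  ∷ S) (more b x) eq =
  let i , i∈ = selected-nonempty S x (ℕ.suc-injective eq) in suc i , Vec.there i∈

∣remaining∣ : ∀ {n d e} (S : Subset n) (x : Selection d e) → ∣ S ∣ ≡ d → ∣ remaining S x ∣ ≡ e
∣remaining∣ []            last       ()
∣remaining∣ []            (more _ _) ()
∣remaining∣ (outside ∷ S) x          eq = ∣remaining∣ S x eq
∣remaining∣ (inside  ∷ S) last       eq = ℕ.suc-injective eq
∣remaining∣ (inside  ∷ S) (more b x) eq = ∣remaining∣ S x (ℕ.suc-injective eq)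

∣survivors∣ : ∀ {n d e} (S : Subset n) (x : Choice d e) → ∣ S ∣ ≡ d → ∣ survivors S x ∣ ≡ e
∣survivors∣ S none     eq = cong suc eq
∣survivors∣ S (some x) eq = ∣remaining∣ S x eq

-- For T = `selected S x` the right-hand side is that of `extend-outer-suc`.
∈-remaining : ∀ {n d e} (S : Subset n) (x : Selection d e) → ∣ S ∣ ≡ d → ∀ i →
              i ∈ remaining S x ⇔ (i ∈ S × (∀ {t} → t ∈ selected S x → t Fin.< i))
∈-remaining S x eq i = mk⇔ (⇒ S x i) (⇐ S x eq i)
  where
  ⇒ : ∀ {n d e} (S : Subset n) (x : Selection d e) i → i ∈ remaining S x →
      i ∈ S × (∀ {t} → t ∈ selected S x → t Fin.< i)
  ⇒ (outside ∷ S) x          (suc i) (Vec.there i∈) = let i∈S , after = ⇒ S x i i∈ in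
    Vec.there i∈S , λ { (Vec.there t∈) → s≤s (after t∈) }
  ⇒ (inside  ∷ S) last       (suc i) (Vec.there i∈) =
    Vec.there i∈ , λ { Vec.here → s≤s z≤n ; (Vec.there t∈) → contradiction t∈ ∉⊥ }
  ⇒ (inside  ∷ S) (more b x) (suc i) (Vec.there i∈) = let i∈S , after = ⇒ S x i i∈ in
    Vec.there i∈S , λ { Vec.here → s≤s z≤n ; (Vec.there t∈) → s≤s (after t∈) }

  ⇐ : ∀ {n d e} (S : Subset n) (x : Selection d e) → ∣ S ∣ ≡ d → ∀ i →
      i ∈ S × (∀ {t} → t ∈ selected S x → t Fin.< i) → i ∈ remaining S x
  ⇐ (outside ∷ S) x          eq (suc i) (Vec.there i∈S , after) =
    Vec.there (⇐ S x eq i (i∈S , λ t∈ → ℕ.≤-pred (after (Vec.there t∈))))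
  ⇐ (inside  ∷ S) last       eq zero    (i∈S , after) = contradiction (after Vec.here) λ ()
  ⇐ (inside  ∷ S) last       eq (suc i) (Vec.there i∈S , after) = Vec.there i∈S
  ⇐ (inside  ∷ S) (more b x) eq zero    (i∈S , after) with selected-nonempty S x (ℕ.suc-injective eq)
  ... | _ , t∈ = contradiction (after (Vec.there t∈)) λ ()
  ⇐ (inside  ∷ S) (more b x) eq (suc i) (Vec.there i∈S , after) =
    Vec.there (⇐ S x (ℕ.suc-injective eq) i (i∈S , λ t∈ → ℕ.≤-pred (after (Vec.there t∈))))

-- The index is compared along with the selection: the selected set also determines how many items
-- follow its greatest element.
selected-injective : ∀ {n d e e′} (S : Subset n) (x : Selection d e) (y : Selection d e′) → ∣ S ∣ ≡ d →
                     selected S x ≡ selected S y → (e , x) ≡ (e′ , y)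
selected-injective []            last       _ () _
selected-injective []            (more _ _) _ () _
selected-injective (outside ∷ S) x          y          eq same = selected-injective S x y eq (∷-injectiveʳ same)
selected-injective (inside  ∷ S) last       last       eq same = refl
selected-injective (inside  ∷ S) last       (more b y) eq same with selected-nonempty S y (ℕ.suc-injective eq)
... | i , i∈ = contradiction (subst (i ∈_) (sym (∷-injectiveʳ same)) i∈) ∉⊥
selected-injective (inside  ∷ S) (more b x) last       eq same with selected-nonempty S x (ℕ.suc-injective eq)
... | i , i∈ = contradiction (subst (i ∈_) (∷-injectiveʳ same) i∈) ∉⊥
selected-injective (inside  ∷ S) (more b x) (more c y) eq same
  with ∷-injectiveˡ same | selected-injective S x y (ℕ.suc-injective eq) (∷-injectiveʳ same)
... | refl | refl = refl

chosen-injective : ∀ {n d e e′} (S : Subset n) (x : Choice d e) (y : Choice d e′) → ∣ S ∣ ≡ d →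
                   chosen S x ≡ chosen S y → (e , x) ≡ (e′ , y)
chosen-injective S none     none     eq same = refl
chosen-injective S none     (some y) eq same with selected-nonempty S y eq
... | i , i∈ = contradiction (subst (i ∈_) (sym same) i∈) ∉⊥
chosen-injective S (some x) none     eq same with selected-nonempty S x eq
... | i , i∈ = contradiction (subst (i ∈_) same i∈) ∉⊥
chosen-injective S (some x) (some y) eq same with selected-injective S x y eq same
... | refl = refl

selected-surjective : ∀ {n} (S : Subset n) {T} → T ⊆ S → Nonempty T →
                      ∃₂ λ e (x : Selection ∣ S ∣ e) → selected S x ≡ T
selected-surjective [] {[]} _ (() , _)
selected-surjective (outside ∷ S) {inside ∷ T} T⊆S _ with T⊆S Vec.here
... | ()
selected-surjective (outside ∷ S) {outside ∷ T} T⊆S (suc i , Vec.there i∈T) =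
  let e , x , eq = selected-surjective S (drop-∷-⊆ T⊆S) (i , i∈T) in e , x , cong (outside ∷_) eq
selected-surjective (inside ∷ S) {b ∷ T} T⊆S ne with nonempty? T
-- A nonempty tail of T means that the head item precedes the greatest selected one, whether or not
-- it is itself in T.
... | yes ne′ = let e , x , eq = selected-surjective S T⊆S′ ne′ in e , more b x , cong (b ∷_) eq
  where
  T⊆S′ : T ⊆ S
  T⊆S′ i∈T = drop-there (T⊆S (Vec.there i∈T))
selected-surjective (inside ∷ S) {.inside ∷ T} T⊆S (zero , Vec.here) | no empty =
  _ , last , cong (inside ∷_) (sym (Empty-unique empty))
selected-surjective (inside ∷ S) {b ∷ T} T⊆S (suc i , Vec.there i∈T) | no empty = contradiction (i , i∈T) empty

chosen-surjective : ∀ {n d} (S : Subset n) {T} → ∣ S ∣ ≡ d → T ⊆ S → ∃₂ λ e (x : Choice d e) → chosen S x ≡ T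
chosen-surjective S {T} refl T⊆S with nonempty? T
... | yes ne   = let e , x , eq = selected-surjective S T⊆S ne in e , some x , eq
... | no empty = _ , none , sym (Empty-unique empty)

survivors-outer : ∀ {n d e} {𝓑 : Subset n → Set} {S} → IsNonCrossingPartition 𝓑 → Singletons 𝓑 S →
                  (x : Choice d e) → ∣ S ∣ ≡ d → Singletons (Extend (chosen S x) 𝓑) (survivors S x)
survivors-outer {S = S} 𝓑-nc S-outer none eq zero =
  mk⇔ (λ _ → from extend-outer-zero refl) (λ _ → Vec.here)
survivors-outer {S = S} 𝓑-nc S-outer none eq (suc i) = mk⇔
  (λ { (Vec.there i∈S) → from outer (i∈S , λ t∈⊥ → contradiction t∈⊥ ∉⊥) })
  (Vec.there ∘ proj₁ ∘ to outer)
  where outer = extend-outer-suc 𝓑-nc S-outer (chosen⊆ S (none {∣ S ∣})) i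
survivors-outer {S = S} 𝓑-nc S-outer (some x) eq zero = mk⇔ (λ ()) λ outer →
  let i , i∈ = selected-nonempty S x eq in contradiction (subst (i ∈_) (to extend-outer-zero outer) i∈) ∉⊥
survivors-outer {S = S} 𝓑-nc S-outer (some x) eq (suc i) = mk⇔
  (λ { (Vec.there i∈) → from outer (to (∈-remaining S x eq i) i∈) })
  (Vec.there ∘ from (∈-remaining S x eq i) ∘ to outer)
  where outer = extend-outer-suc 𝓑-nc S-outer (chosen⊆ S (some x)) i

-- Extending partitions given as lists of blocks

extend-cong : ∀ {n} {T : Subset n} {𝓑 𝓒 : Subset n → Set} → (∀ B → 𝓑 B ⇔ 𝓒 B) →
              ∀ B → Extend T 𝓑 B ⇔ Extend T 𝓒 B
extend-cong 𝓑⇔𝓒 (inside  ∷ B) = mk⇔ id id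
extend-cong 𝓑⇔𝓒 (outside ∷ B) = mk⇔
  (λ (B∈ , empty) → to (𝓑⇔𝓒 B) B∈ , empty) (λ (B∈ , empty) → from (𝓑⇔𝓒 B) B∈ , empty)

outer-cong : ∀ {n} {𝓑 𝓒 : Subset n → Set} → (∀ B → 𝓑 B ⇔ 𝓒 B) → ∀ i → Outer 𝓑 i → Outer 𝓒 i
outer-cong 𝓑⇔𝓒 i (single , uncovered) = to (𝓑⇔𝓒 _) single , uncovered ∘ from (𝓑⇔𝓒 _)

disjointFrom? : ∀ {n} (T B : Subset n) → Dec (Empty (B ∩ T))
disjointFrom? T B = ¬? (nonempty? (B ∩ T))

extend : ∀ {n} → Subset n → List (Subset n) → List (Subset (suc n))
extend T Bs = (inside ∷ T) ∷ List.map (outside ∷_) (filter (disjointFrom? T) Bs)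

∈-extend : ∀ {n} (T : Subset n) Bs B → B ∈ₗ extend T Bs ⇔ Extend T (_∈ₗ Bs) B
∈-extend T Bs (inside ∷ B) = mk⇔ ⇒ (λ { refl → here refl })
  where
  ⇒ : inside ∷ B ∈ₗ extend T Bs → B ≡ T
  ⇒ (here refl) = refl
  ⇒ (there B∈) with ∈-map⁻ (outside ∷_) B∈
  ... | _ , _ , ()
∈-extend T Bs (outside ∷ B) = mk⇔ ⇒
  (λ (B∈ , empty) → there (∈-map⁺ (outside ∷_) (∈-filter⁺ (disjointFrom? T) B∈ empty)))
  where
  ⇒ : outside ∷ B ∈ₗ extend T Bs → Extend T (_∈ₗ Bs) (outside ∷ B)
  ⇒ (there B∈) with ∈-map⁻ (outside ∷_) B∈
  ... | _ , B∈′ , refl = ∈-filter⁻ (disjointFrom? T) {xs = Bs} B∈′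

extend-nonempty : ∀ {n} {T : Subset n} {Bs} → All Nonempty Bs → All Nonempty (extend T Bs)
extend-nonempty ne = (zero , Vec.here) ∷
  All.map⁺ (All.map (λ (i , i∈B) → suc i , Vec.there i∈B) (All.filter⁺ (disjointFrom? _) ne))

extend-allPairs : ∀ {n} {T : Subset n} {Bs} → AllPairs (λ B C → Empty (B ∩ C)) Bs →
                  AllPairs (λ B C → Empty (B ∩ C)) (extend T Bs)
extend-allPairs {T = T} {Bs} dj =
  All.map⁺ (All.map (λ { empty (suc i , Vec.there i∈) → empty (i , x∈p∩q⁺ (swap (x∈p∩q⁻ T _ i∈))) })
    (All.all-filter (disjointFrom? T) Bs)) ∷
  AllPairs.map⁺ (AllPairs.map (λ { empty (suc i , Vec.there i∈) → empty (i , i∈) })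
    (AllPairs.filter⁺ (disjointFrom? T) dj))

module _ {n} (P : Partition n) (P-nc : NonCrossing P) {S T : Subset n}
         (S-outer : Singletons (_∈ₗ blocks P) S) (T⊆S : T ⊆ S) where

  extendPartition : Partition (suc n)
  extendPartition = record
    { blocks   = extend T (blocks P)
    ; nonempty = extend-nonempty (nonempty P)
    ; disjoint = extend-allPairs (disjoint P)
    ; covers   = λ i → let B , B∈ , i∈B = extend-total (isNonCrossingPartition P P-nc) S-outer T⊆S i in
                       lose (from (∈-extend T (blocks P) B) B∈) i∈B
    }

  extendPartition-nonCrossing : NonCrossing extendPartition
  extendPartition-nonCrossing a<b b<c c<d B∈ C∈ =
    extend-noncrossing (isNonCrossingPartition P P-nc) S-outer T⊆S a<b b<c c<d
      (to (∈-extend T (blocks P) _) B∈) (to (∈-extend T (blocks P) _) C∈)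

-- Coding non-crossing partitions

-- The history of a partition that is built up from its last vertex to its first. The second index,
-- the number of outer singletons, is all that the next choice depends on.
data Code : ℕ → ℕ → Set where
  start : Code 0 0
  step  : ∀ {n d e} → Code n d → Choice d e → Code (suc n) e

singletons : ∀ {n d} → Code n d → Subset n
singletons start      = []
singletons (step c x) = survivors (singletons c) x

∣singletons∣ : ∀ {n d} (c : Code n d) → ∣ singletons c ∣ ≡ d
∣singletons∣ start      = refl
∣singletons∣ (step c x) = ∣survivors∣ (singletons c) x (∣singletons∣ c)

mutual
  -- Mutual with the next two, because `extendPartition` demands that the previous stage be
  -- non-crossing and that the joined points be outer singletons of it.
  partition : ∀ {n d} → Code n d → Partition n
  partition start = record { blocks = [] ; nonempty = [] ; disjoint = [] ; covers = λ () }
  partition (step c x) = extendPartition (partition c) (partition-nonCrossing c) (singletons-outer c)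
    (chosen⊆ (singletons c) x)

  partition-nonCrossing : ∀ {n d} (c : Code n d) → NonCrossing (partition c)
  partition-nonCrossing start {a = ()}
  partition-nonCrossing (step c x) = extendPartition-nonCrossing (partition c) (partition-nonCrossing c)
    (singletons-outer c) (chosen⊆ (singletons c) x)

  singletons-outer : ∀ {n d} (c : Code n d) → Singletons (_∈ₗ blocks (partition c)) (singletons c)
  singletons-outer start ()
  singletons-outer (step c x) i = mk⇔
    (outer-cong (λ B → ⇔.sym (blocks-step B)) i ∘ to outer)
    (from outer ∘ outer-cong blocks-step i)
    where
    blocks-step = ∈-extend (chosen (singletons c) x) (blocks (partition c))
    outer = survivors-outer (isNonCrossingPartition (partition c) (partition-nonCrossing c))
              (singletons-outer c) x (∣singletons∣ c) i

-- Stated for predicates, as the induction passes to `Shatter T 𝓑`. By `shatter-outer` the other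
-- points T of the first block are outer singletons there, hence arise from some choice.
code-surjective : ∀ {n} {𝓑 : Subset n → Set} → IsNonCrossingPartition 𝓑 →
                  ∃₂ λ d (c : Code n d) → ∀ B → B ∈ₗ blocks (partition c) ⇔ 𝓑 B
code-surjective {zero} {𝓑} 𝓑-nc = 0 , start , λ B → mk⇔ (λ ()) λ B∈ → contradiction (inhabited 𝓑-nc B∈) λ ()
code-surjective {suc n} {𝓑} 𝓑-nc with total 𝓑-nc zero
... | inside ∷ T , T∈ , Vec.here with code-surjective (shatter-nc 𝓑-nc T∈)
...   | d , c , c∼ with chosen-surjective (singletons c) {T} (∣singletons∣ c)
                        (λ {t} t∈T → from (singletons-outer c t) (outer-cong (λ B → ⇔.sym (c∼ B)) t (shatter-outer 𝓑-nc T∈ t∈T)))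
...     | e , x , refl = e , step c x , λ B →
  ⇔.trans (∈-extend _ _ B) (⇔.trans (extend-cong c∼ B) (⇔.sym (extend-shatter 𝓑-nc T∈ B)))

shatter-cong : ∀ {n} {T : Subset n} {𝓑 𝓒 : Subset (suc n) → Set} → (∀ B → 𝓑 B ⇔ 𝓒 B) →
               ∀ B → Shatter T 𝓑 B ⇔ Shatter T 𝓒 B
shatter-cong 𝓑⇔𝓒 B = mk⇔ (Sum.map₁ (to (𝓑⇔𝓒 _))) (Sum.map₁ (from (𝓑⇔𝓒 _)))

shatter-step : ∀ {n d e} (c : Code n d) (x : Choice d e) → ∀ B →
               B ∈ₗ blocks (partition c) ⇔ Shatter (chosen (singletons c) x) (_∈ₗ blocks (partition (step c x))) B
shatter-step c x B = ⇔.trans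
  (shatter-extend (isNonCrossingPartition (partition c) (partition-nonCrossing c))
    (singletons-outer c) (chosen⊆ (singletons c) x) B)
  (shatter-cong (λ B → ⇔.sym (∈-extend (chosen (singletons c) x) (blocks (partition c)) B)) B)

-- The block of the first vertex gives back the chosen set, and shattering along it the blocks of
-- the parent. The choices can be compared only once the parents, and with them the degrees, are
-- identified; therefore the conclusion is about pairs.
code-injective : ∀ {n d d′} (c : Code n d) (c′ : Code n d′) →
                 (∀ B → B ∈ₗ blocks (partition c) ⇔ B ∈ₗ blocks (partition c′)) → (d , c) ≡ (d′ , c′)
code-injective start start _ = refl
code-injective (step {d = d} c x) (step {d = d′} c′ x′) same = conclude (code-injective c c′ parents-same)
  where
  chosen-same : chosen (singletons c) x ≡ chosen (singletons c′) x′
  chosen-same = to (∈-extend _ (blocks (partition c′)) (inside ∷ _)) (to (same _) (here refl))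

  parents-same : ∀ B → B ∈ₗ blocks (partition c) ⇔ B ∈ₗ blocks (partition c′)
  parents-same B = ⇔.trans (shatter-step c x B) (⇔.trans (shatter-cong same B)
    (subst (λ T → Shatter T (_∈ₗ blocks (partition (step c′ x′))) B ⇔ B ∈ₗ blocks (partition c′)) (sym chosen-same) (⇔.sym (shatter-step c′ x′ B))))

  conclude : (d , c) ≡ (d′ , c′) → (_ , step c x) ≡ (_ , step c′ x′)
  conclude refl with chosen-injective (singletons c) x x′ (∣singletons∣ c) chosen-same
  ... | refl = refl

-- Counting codes

module Counting where
  open import Data.Nat.Base using (_+_; _*_; _<_; _≤_)

  δ : ℕ → ℕ → ℕ
  δ zero    zero    = 1
  δ zero    (suc n) = 0
  δ (suc m) zero    = 0
  δ (suc m) (suc n) = δ m n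

  δ↔≡ : ∀ m n → Fin (δ m n) ↔ m ≡ n
  δ↔≡ zero    zero    = mk↔ₛ′ (λ _ → refl) (λ _ → zero) (λ { refl → refl }) (λ { zero → refl })
  δ↔≡ zero    (suc n) = mk↔ₛ′ (λ ()) (λ ()) (λ ()) (λ ())
  δ↔≡ (suc m) zero    = mk↔ₛ′ (λ ()) (λ ()) (λ ()) (λ ())
  δ↔≡ (suc m) (suc n) = ↔-trans (δ↔≡ m n)
    (mk↔ₛ′ (cong suc) ℕ.suc-injective (λ _ → ℕ.≡-irrelevant _ _) (λ _ → ℕ.≡-irrelevant _ _))

  Σ< : ℕ → (ℕ → ℕ) → ℕ
  Σ< n f = sum (applyUpTo f n)

  Σ<↔∃ : ∀ {A : ℕ → Set} {f} → (∀ d → Fin (f d) ↔ A d) → ∀ n → Fin (Σ< n f) ↔ (∃ λ d → d < n × A d)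
  Σ<↔∃ f↔A zero = mk↔ₛ′ (λ ()) (λ { (_ , () , _) }) (λ { (_ , () , _) }) (λ ())
  Σ<↔∃ {A} f↔A (suc n) = ↔-trans Fin.+↔⊎ (↔-trans (f↔A 0 ⊎-↔ Σ<↔∃ (f↔A ∘ suc) n) split)
    where
    split : (A 0 ⊎ ∃ λ d → d < n × A (suc d)) ↔ (∃ λ d → d < suc n × A d)
    split = mk↔ₛ′
      (λ { (inj₁ a) → 0 , s≤s z≤n , a ; (inj₂ (d , d<n , a)) → suc d , s≤s d<n , a })
      (λ { (zero , _ , a) → inj₁ a ; (suc d , s≤s d<n , a) → inj₂ (d , d<n , a) })
      (λ { (zero , s≤s z≤n , a) → refl ; (suc d , s≤s d<n , a) → refl })
      (λ { (inj₁ a) → refl ; (inj₂ (d , d<n , a)) → refl })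

  -- This is 2^(d-1-e) for e < d and 0 otherwise: the items before the greatest selected one are
  -- free.
  selections : ℕ → ℕ → ℕ
  selections zero    e = 0
  selections (suc d) e = δ d e + 2 * selections d e

  selections↔Selection : ∀ d e → Fin (selections d e) ↔ Selection d e
  selections↔Selection zero    e = mk↔ₛ′ (λ ()) (λ ()) (λ ()) (λ ())
  selections↔Selection (suc d) e = ↔-trans Fin.+↔⊎
    (↔-trans (δ↔≡ d e ⊎-↔ ↔-trans Fin.*↔× (Fin.2↔Bool ×-↔ selections↔Selection d e))
      (mk↔ₛ′ (λ { (inj₁ refl) → last ; (inj₂ (b , x)) → more b x })
             (λ { last → inj₁ refl ; (more b x) → inj₂ (b , x) })
             (λ { last → refl ; (more b x) → refl })
             (λ { (inj₁ refl) → refl ; (inj₂ (b , x)) → refl })))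

  choices : ℕ → ℕ → ℕ
  choices d e = δ (suc d) e + selections d e

  choices↔Choice : ∀ d e → Fin (choices d e) ↔ Choice d e
  choices↔Choice d e = ↔-trans Fin.+↔⊎ (↔-trans (δ↔≡ (suc d) e ⊎-↔ selections↔Selection d e)
    (mk↔ₛ′ (λ { (inj₁ refl) → none ; (inj₂ x) → some x })
           (λ { none → inj₁ refl ; (some x) → inj₂ x })
           (λ { none → refl ; (some x) → refl })
           (λ { (inj₁ refl) → refl ; (inj₂ x) → refl })))

  count : ℕ → ℕ → ℕ
  count zero    d = δ 0 d
  -- The range d ≤ n is exhaustive, since each vertex adds at most one outer singleton; see
  -- `Code-≤`.
  count (suc n) e = Σ< (suc n) λ d → count n d * choices d e

  Selection-< : ∀ {d e} → Selection d e → e < d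
  Selection-< last       = ℕ.≤-refl
  Selection-< (more _ x) = ℕ.m≤n⇒m≤1+n (Selection-< x)

  Choice-≤ : ∀ {d e} → Choice d e → e ≤ suc d
  Choice-≤ none     = ℕ.≤-refl
  Choice-≤ (some x) = ℕ.m≤n⇒m≤1+n (ℕ.<⇒≤ (Selection-< x))

  Code-≤ : ∀ {n d} → Code n d → d ≤ n
  Code-≤ start      = z≤n
  Code-≤ (step c x) = ℕ.≤-trans (Choice-≤ x) (s≤s (Code-≤ c))

  count↔Code : ∀ n d → Fin (count n d) ↔ Code n d
  count↔Code zero d = ↔-trans (δ↔≡ 0 d)
    (mk↔ₛ′ (λ { refl → start }) (λ { start → refl }) (λ { start → refl }) (λ { refl → refl }))
  count↔Code (suc n) e = ↔-trans
    (Σ<↔∃ (λ d → ↔-trans Fin.*↔× (count↔Code n d ×-↔ choices↔Choice d e)) (suc n))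
    (mk↔ₛ′ (λ { (_ , _ , c , x) → step c x })
           (λ { (step c x) → _ , s≤s (Code-≤ c) , c , x })
           (λ { (step c x) → refl })
           (λ { (d , d<1+n , c , x) → cong (λ d<1+n → d , d<1+n , c , x) (ℕ.≤-irrelevant _ _) }))

  Fin-empty⇒≡0 : ∀ {n} → ¬ Fin n → n ≡ 0
  Fin-empty⇒≡0 {zero}  _ = refl
  Fin-empty⇒≡0 {suc n} ¬Fin = contradiction zero ¬Fin

  count≡0 : ∀ {n d} → n < d → count n d ≡ 0
  count≡0 {n} {d} n<d = Fin-empty⇒≡0 λ i → ℕ.<⇒≱ n<d (Code-≤ (Inverse.to (count↔Code n d) i))

  Σ<-cong : ∀ n {f g : ℕ → ℕ} → (∀ d → f d ≡ g d) → Σ< n f ≡ Σ< n g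
  Σ<-cong zero    f≗g = refl
  Σ<-cong (suc n) f≗g = cong₂ _+_ (f≗g 0) (Σ<-cong n (f≗g ∘ suc))

  Σ<-zero : ∀ n {f : ℕ → ℕ} → (∀ d → f d ≡ 0) → Σ< n f ≡ 0
  Σ<-zero zero    f≗0 = refl
  Σ<-zero (suc n) f≗0 = cong₂ _+_ (f≗0 0) (Σ<-zero n (f≗0 ∘ suc))

  Σ<-+ : ∀ n (f g : ℕ → ℕ) → Σ< n (λ d → f d + g d) ≡ Σ< n f + Σ< n g
  Σ<-+ zero    f g = refl
  Σ<-+ (suc n) f g = trans (cong (λ x → f 0 + g 0 + x) (Σ<-+ n (f ∘ suc) (g ∘ suc)))
    (solve 4 (λ a b c d → a :+ b :+ (c :+ d) := a :+ c :+ (b :+ d)) refl (f 0) (g 0) _ _)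
    where open ℕ.+-*-Solver

  Σ<-* : ∀ n c (f : ℕ → ℕ) → Σ< n (λ d → c * f d) ≡ c * Σ< n f
  Σ<-* zero    c f = sym (ℕ.*-zeroʳ c)
  Σ<-* (suc n) c f = trans (cong (λ x → c * f 0 + x) (Σ<-* n c (f ∘ suc))) (sym (ℕ.*-distribˡ-+ c (f 0) _))

  Σ<-δ : ∀ n (f : ℕ → ℕ) e → (∀ {d} → n ≤ d → f d ≡ 0) → Σ< n (λ d → f d * δ d e) ≡ f e
  Σ<-δ zero    f e       f≡0 = sym (f≡0 z≤n)
  Σ<-δ (suc n) f zero    f≡0 = trans (cong₂ _+_ (ℕ.*-identityʳ (f 0)) (Σ<-zero n λ d → ℕ.*-zeroʳ (f (suc d)))) (ℕ.+-identityʳ (f 0))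
  Σ<-δ (suc n) f (suc e) f≡0 = trans (cong (_+ Σ< n (λ d → f (suc d) * δ d e)) (ℕ.*-zeroʳ (f 0)))
    (Σ<-δ n (f ∘ suc) e (f≡0 ∘ s≤s))

  selections-rec : ∀ d e → selections d e ≡ δ d (suc e) + 2 * selections d (suc e)
  selections-rec zero    e = refl
  selections-rec (suc d) e = cong (λ s → δ d e + 2 * s) (selections-rec d e)

  choices-rec : ∀ d e → choices d e + 2 * δ d e ≡ δ (suc d) e + δ d (suc e) + 2 * choices d (suc e)
  choices-rec d e = trans (cong (λ s → δ (suc d) e + s + 2 * δ d e) (selections-rec d e))
    (solve 4 (λ a b c s → a :+ (b :+ con 2 :* s) :+ con 2 :* c := a :+ b :+ con 2 :* (c :+ s)) refl
      (δ (suc d) e) (δ d (suc e)) (δ d e) (selections d (suc e)))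
    where open ℕ.+-*-Solver

  -- shifted n j is the paper's v_j^n, extended by 0 to j = 0.
  shifted : ℕ → ℕ → ℕ
  shifted n zero    = 0
  shifted n (suc d) = count n d

  Σ<-δ-suc : ∀ n e → Σ< (suc n) (λ d → count n d * δ (suc d) e) ≡ shifted n e
  Σ<-δ-suc n zero    = Σ<-zero (suc n) λ d → ℕ.*-zeroʳ (count n d)
  Σ<-δ-suc n (suc e) = Σ<-δ (suc n) (count n) e count≡0

  -- Subtracting twice the instance at `suc e` cancels all but the first term of the sum over powers
  -- of two. What would be subtracted is moved to the other side, to stay within ℕ.
  count-rec : ∀ n e → count (suc n) e + 2 * count n e ≡
                      shifted n e + count n (suc e) + 2 * count (suc n) (suc e)
  count-rec n e = begin
    count (suc n) e + 2 * count n e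
      ≡⟨ cong (λ s → count (suc n) e + 2 * s) (Σ<-δ (suc n) (count n) e count≡0) ⟨
    count (suc n) e + 2 * Σ< (suc n) (on δ₀)
      ≡⟨ cong (λ x → count (suc n) e + x) (Σ<-* (suc n) 2 (on δ₀)) ⟨
    count (suc n) e + Σ< (suc n) (λ d → 2 * on δ₀ d)
      ≡⟨ Σ<-+ (suc n) (on χ) (λ d → 2 * on δ₀ d) ⟨
    Σ< (suc n) (λ d → on χ d + 2 * on δ₀ d)
      ≡⟨ Σ<-cong (suc n) (λ d → trans
           (solve 3 (λ a b c → a :* b :+ con 2 :* (a :* c) := a :* (b :+ con 2 :* c)) refl (count n d) (choices d e) (δ d e))
           (trans (cong (count n d *_) (choices-rec d e))
           (solve 4 (λ a b c s → a :* (b :+ c :+ con 2 :* s) := a :* b :+ a :* c :+ con 2 :* (a :* s)) refl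
             (count n d) (δ (suc d) e) (δ d (suc e)) (choices d (suc e))))) ⟩
    Σ< (suc n) (λ d → on δ₋ d + on δ₊ d + 2 * on χ₊ d)
      ≡⟨ Σ<-+ (suc n) (λ d → on δ₋ d + on δ₊ d) (λ d → 2 * on χ₊ d) ⟩
    Σ< (suc n) (λ d → on δ₋ d + on δ₊ d) +
    Σ< (suc n) (λ d → 2 * on χ₊ d)
      ≡⟨ cong₂ _+_ (Σ<-+ (suc n) (on δ₋) (on δ₊)) (Σ<-* (suc n) 2 (on χ₊)) ⟩
    Σ< (suc n) (on δ₋) + Σ< (suc n) (on δ₊) +
    2 * count (suc n) (suc e)
      ≡⟨ cong₂ (λ a b → a + b + 2 * count (suc n) (suc e)) (Σ<-δ-suc n e) (Σ<-δ (suc n) (count n) (suc e) count≡0) ⟩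
    shifted n e + count n (suc e) + 2 * count (suc n) (suc e) ∎
    where
    open ≡-Reasoning
    open ℕ.+-*-Solver

    δ₀ δ₋ δ₊ χ χ₊ : ℕ → ℕ
    δ₀ d = δ d e
    δ₋ d = δ (suc d) e
    δ₊ d = δ d (suc e)
    χ  d = choices d e
    χ₊ d = choices d (suc e)

    on : (ℕ → ℕ) → ℕ → ℕ
    on f d = count n d * f d

open Counting

-- Lagrange inversion by recurrences

module LagrangeInversion where
  open import Data.Integer.Base using (_+_; _*_; _-_)
  open ℤ.+-*-Solver using (solve; Polynomial; _:=_; _:+_; _:*_; _:-_; :-_; con)

  -- Multiplication by w² / (1 - 2w), on sequences of coefficients.
  geometric : (ℕ → ℕ) → ℕ → ℕ
  geometric f zero          = 0
  geometric f (suc zero)    = 0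
  geometric f (suc (suc k)) = 2 ℕ.* geometric f (suc k) ℕ.+ f k

  -- power m (4 + r) is the coefficient of w^r in φ^m; the four leading zeros make
  -- the recurrences below hold at every index.
  power : ℕ → ℕ → ℕ
  power zero    k = δ 4 k
  power (suc m) k = power m k ℕ.+ geometric (power m) k

  coeff : ℕ → ℕ → ℤ
  coeff m k = + power m k

  geometric-zero : ∀ {f n} → (∀ {k} → k ℕ.< n → f k ≡ 0) → ∀ {k} → k ℕ.< 2 ℕ.+ n → geometric f k ≡ 0
  geometric-zero f≡0 {zero}        _ = refl
  geometric-zero f≡0 {suc zero}    _ = refl
  geometric-zero f≡0 {suc (suc k)} (s≤s (s≤s k<n)) =
    cong₂ (λ x y → 2 ℕ.* x ℕ.+ y) (geometric-zero f≡0 (s≤s (ℕ.m≤n⇒m≤1+n k<n))) (f≡0 k<n)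

  power-zero : ∀ m {k} → k ℕ.< 4 → power m k ≡ 0
  power-zero zero {0} _ = refl
  power-zero zero {1} _ = refl
  power-zero zero {2} _ = refl
  power-zero zero {3} _ = refl
  power-zero zero {suc (suc (suc (suc _)))} (s≤s (s≤s (s≤s (s≤s ()))))
  power-zero (suc m) k<4 = cong₂ ℕ._+_ (power-zero m k<4) (geometric-zero (power-zero m) (ℕ.m≤n⇒m≤1+n (ℕ.m≤n⇒m≤1+n k<4)))

  -- The coefficient form of (1 - 2w) φ^(m+1) = (1 - w)² φ^m, solved for the leading coefficient of
  -- φ^(m+1); x belongs to φ^(m+1), y to φ^m.
  next : ℤ → ℤ → ℤ → ℤ → ℤ
  next x₁ y₂ y₁ y₀ = + 2 * x₁ + y₂ - + 2 * y₁ + y₀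

  :next : ∀ {n} (x₁ y₂ y₁ y₀ : Polynomial n) → Polynomial n
  :next x₁ y₂ y₁ y₀ = con (+ 2) :* x₁ :+ y₂ :- con (+ 2) :* y₁ :+ y₀

  coeff-rec : ∀ m k → coeff (suc m) (2 ℕ.+ k) ≡ next (coeff (suc m) (1 ℕ.+ k)) (coeff m (2 ℕ.+ k)) (coeff m (1 ℕ.+ k)) (coeff m k)
  coeff-rec m k = begin
    + (power m (2 ℕ.+ k) ℕ.+ (2 ℕ.* geometric (power m) (1 ℕ.+ k) ℕ.+ power m k))
      ≡⟨ cong (λ x → coeff m (2 ℕ.+ k) + (x + coeff m k)) (ℤ.pos-* 2 (geometric (power m) (1 ℕ.+ k))) ⟩
    coeff m (2 ℕ.+ k) + (+ 2 * + geometric (power m) (1 ℕ.+ k) + coeff m k)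
      ≡⟨ solve 4 (λ y₂ y₁ y₀ x → y₂ :+ (con (+ 2) :* x :+ y₀) := :next (y₁ :+ x) y₂ y₁ y₀) refl
           (coeff m (2 ℕ.+ k)) (coeff m (1 ℕ.+ k)) (coeff m k) (+ geometric (power m) (1 ℕ.+ k)) ⟩
    next (coeff (suc m) (1 ℕ.+ k)) (coeff m (2 ℕ.+ k)) (coeff m (1 ℕ.+ k)) (coeff m k) ∎
    where open ≡-Reasoning

  -- Because of the shift by 4, index 2 + k belongs to w^(k-2). This is the coefficient of w^(k-2)
  -- in (1 - w)(1 - 2w) w f′ - 2m w² f.
  ode : (m k x₂ x₁ x₀ : ℤ) → ℤ
  ode m k x₂ x₁ x₀ = (k - + 2) * x₂ - + 3 * (k - + 3) * x₁ + + 2 * (k - + 4) * x₀ - + 2 * m * x₀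

  :ode : ∀ {n} (m k x₂ x₁ x₀ : Polynomial n) → Polynomial n
  :ode m k x₂ x₁ x₀ = (k :- con (+ 2)) :* x₂ :- con (+ 3) :* (k :- con (+ 3)) :* x₁ :+ con (+ 2) :* (k :- con (+ 4)) :* x₀ :- con (+ 2) :* m :* x₀

  Ode : ℕ → ℕ → ℤ
  Ode m k = ode (+ m) (+ k) (coeff m (2 ℕ.+ k)) (coeff m (1 ℕ.+ k)) (coeff m k)

  ode-0 : ∀ m k → ode m k 0ℤ 0ℤ 0ℤ ≡ 0ℤ
  ode-0 = solve 2 (λ m k → :ode m k (con 0ℤ) (con 0ℤ) (con 0ℤ) := con 0ℤ) refl

  -- Passing from φ^m to φ^(m+1) multiplies the expression behind `ode` by φ, so its coefficients
  -- obey the recurrence `next` as well.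
  ode-step : ∀ m k y₄ y₃ y₂ y₁ y₀ x₁ {x₂ x₃ x₄} →
    x₂ ≡ next x₁ y₂ y₁ y₀ → x₃ ≡ next x₂ y₃ y₂ y₁ → x₄ ≡ next x₃ y₄ y₃ y₂ →
    ode (1ℤ + m) (+ 2 + k) x₄ x₃ x₂ ≡
    + 2 * ode (1ℤ + m) (1ℤ + k) x₃ x₂ x₁ +
    (ode m (+ 2 + k) y₄ y₃ y₂ - + 2 * ode m (1ℤ + k) y₃ y₂ y₁ + ode m k y₂ y₁ y₀)
  ode-step m k y₄ y₃ y₂ y₁ y₀ x₁ refl refl refl = solve 8 (λ m k y₄ y₃ y₂ y₁ y₀ x₁ →
    let x₂ = :next x₁ y₂ y₁ y₀ ; x₃ = :next x₂ y₃ y₂ y₁ ; x₄ = :next x₃ y₄ y₃ y₂ in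
    :ode (con 1ℤ :+ m) (con (+ 2) :+ k) x₄ x₃ x₂ :=
    con (+ 2) :* :ode (con 1ℤ :+ m) (con 1ℤ :+ k) x₃ x₂ x₁ :+
    (:ode m (con (+ 2) :+ k) y₄ y₃ y₂ :- con (+ 2) :* :ode m (con 1ℤ :+ k) y₃ y₂ y₁ :+ :ode m k y₂ y₁ y₀))
    refl m k y₄ y₃ y₂ y₁ y₀ x₁

  coeff-zero : ∀ m {k} → k ℕ.< 4 → coeff m k ≡ 0ℤ
  coeff-zero m k<4 = cong +_ (power-zero m k<4)

  2<4 : 2 ℕ.< 4
  2<4 = ℕ.m≤m+n 3 1

  3<4 : 3 ℕ.< 4
  3<4 = ℕ.≤-refl

  -- Here the leading zeros pay off: both initial values of the recurrence in k involve nothing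
  -- else.
  Ode-0 : ∀ m {k} → 2 ℕ.+ k ℕ.< 4 → Ode m k ≡ 0ℤ
  Ode-0 m {k} 2+k<4 = begin
    ode (+ m) (+ k) (coeff m (2 ℕ.+ k)) (coeff m (1 ℕ.+ k)) (coeff m k)
      ≡⟨ cong₂ (λ x₂ x₁ → ode (+ m) (+ k) x₂ x₁ (coeff m k)) (coeff-zero m 2+k<4) (coeff-zero m 1+k<4) ⟩
    ode (+ m) (+ k) 0ℤ 0ℤ (coeff m k)
      ≡⟨ cong (ode (+ m) (+ k) 0ℤ 0ℤ) (coeff-zero m (ℕ.<-trans (ℕ.n<1+n k) 1+k<4)) ⟩
    ode (+ m) (+ k) 0ℤ 0ℤ 0ℤ
      ≡⟨ ode-0 (+ m) (+ k) ⟩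
    0ℤ ∎
    where
    open ≡-Reasoning
    1+k<4 : 1 ℕ.+ k ℕ.< 4
    1+k<4 = ℕ.<-trans (ℕ.n<1+n (1 ℕ.+ k)) 2+k<4

  -- (1 - w)(1 - 2w) f′ = 2m w f for f = φ^m, φ = (1 - w)² / (1 - 2w).
  Ode-zero : ∀ m k → Ode m k ≡ 0ℤ
  Ode-zero zero 0 = refl
  Ode-zero zero 1 = refl
  Ode-zero zero 2 = refl
  Ode-zero zero 3 = refl
  Ode-zero zero 4 = refl
  Ode-zero zero (suc (suc (suc (suc (suc k))))) = ode-0 0ℤ (+ (5 ℕ.+ k))
  Ode-zero (suc m) 0 = Ode-0 (suc m) 2<4
  Ode-zero (suc m) 1 = Ode-0 (suc m) 3<4
  Ode-zero (suc m) (suc (suc k)) = begin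
    Ode (suc m) (2 ℕ.+ k)
      ≡⟨ ode-step (+ m) (+ k) (coeff m (4 ℕ.+ k)) (coeff m (3 ℕ.+ k)) (coeff m (2 ℕ.+ k)) (coeff m (1 ℕ.+ k)) (coeff m k)
           (coeff (suc m) (1 ℕ.+ k)) (coeff-rec m k) (coeff-rec m (1 ℕ.+ k)) (coeff-rec m (2 ℕ.+ k)) ⟩
    + 2 * Ode (suc m) (1 ℕ.+ k) + (Ode m (2 ℕ.+ k) - + 2 * Ode m (1 ℕ.+ k) + Ode m k)
      ≡⟨ vanish (Ode-zero (suc m) (suc k)) (Ode-zero m (2 ℕ.+ k)) (Ode-zero m (1 ℕ.+ k)) (Ode-zero m k) ⟩
    0ℤ ∎
    where
    open ≡-Reasoning
    vanish : ∀ {x y₂ y₁ y₀} → x ≡ 0ℤ → y₂ ≡ 0ℤ → y₁ ≡ 0ℤ → y₀ ≡ 0ℤ → + 2 * x + (y₂ - + 2 * y₁ + y₀) ≡ 0ℤ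
    vanish refl refl refl refl = refl

  -- The coefficient of w^(k-2) in w (m (1 - 2w) (φ^(m+1))′ - (m + 1) (1 - w)² (φ^m)′).
  derivative : (m k x₂ x₁ y₂ y₁ y₀ : ℤ) → ℤ
  derivative m k x₂ x₁ y₂ y₁ y₀ =
    m * ((k - + 2) * x₂ - + 2 * (k - + 3) * x₁) -
    (1ℤ + m) * ((k - + 2) * y₂ - + 2 * (k - + 3) * y₁ + (k - + 4) * y₀)

  :derivative : ∀ {n} (m k x₂ x₁ y₂ y₁ y₀ : Polynomial n) → Polynomial n
  :derivative m k x₂ x₁ y₂ y₁ y₀ =
    m :* ((k :- con (+ 2)) :* x₂ :- con (+ 2) :* (k :- con (+ 3)) :* x₁) :-
    (con 1ℤ :+ m) :* ((k :- con (+ 2)) :* y₂ :- con (+ 2) :* (k :- con (+ 3)) :* y₁ :+ (k :- con (+ 4)) :* y₀)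

  Derivative : ℕ → ℕ → ℤ
  Derivative m k = derivative (+ m) (+ k) (coeff (suc m) (2 ℕ.+ k)) (coeff (suc m) (1 ℕ.+ k))
                     (coeff m (2 ℕ.+ k)) (coeff m (1 ℕ.+ k)) (coeff m k)

  -- Multiplication by (1 - w)(1 - 2w), the source of the 3 and the 2, allows both derivatives to be
  -- replaced by means of `ode`. What is left over, 2m(m + 1) w² times (1 - 2w) φ^(m+1) - (1 - w)²
  -- φ^m, is zero.
  derivative-step : ∀ m k y₄ y₃ y₂ y₁ y₀ x₁ {x₂ x₃ x₄} →
    x₂ ≡ next x₁ y₂ y₁ y₀ → x₃ ≡ next x₂ y₃ y₂ y₁ → x₄ ≡ next x₃ y₄ y₃ y₂ →
    derivative m (+ 2 + k) x₄ x₃ y₄ y₃ y₂ ≡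
    + 3 * derivative m (1ℤ + k) x₃ x₂ y₃ y₂ y₁ - + 2 * derivative m k x₂ x₁ y₂ y₁ y₀ +
    (m * (ode (1ℤ + m) (+ 2 + k) x₄ x₃ x₂ - + 2 * ode (1ℤ + m) (1ℤ + k) x₃ x₂ x₁) -
    (1ℤ + m) * (ode m (+ 2 + k) y₄ y₃ y₂ - + 2 * ode m (1ℤ + k) y₃ y₂ y₁ + ode m k y₂ y₁ y₀))
  derivative-step m k y₄ y₃ y₂ y₁ y₀ x₁ refl refl refl = solve 8 (λ m k y₄ y₃ y₂ y₁ y₀ x₁ →
    let x₂ = :next x₁ y₂ y₁ y₀ ; x₃ = :next x₂ y₃ y₂ y₁ ; x₄ = :next x₃ y₄ y₃ y₂ in
    :derivative m (con (+ 2) :+ k) x₄ x₃ y₄ y₃ y₂ :=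
    con (+ 3) :* :derivative m (con 1ℤ :+ k) x₃ x₂ y₃ y₂ y₁ :- con (+ 2) :* :derivative m k x₂ x₁ y₂ y₁ y₀ :+
    (m :* (:ode (con 1ℤ :+ m) (con (+ 2) :+ k) x₄ x₃ x₂ :- con (+ 2) :* :ode (con 1ℤ :+ m) (con 1ℤ :+ k) x₃ x₂ x₁) :-
    (con 1ℤ :+ m) :* (:ode m (con (+ 2) :+ k) y₄ y₃ y₂ :- con (+ 2) :* :ode m (con 1ℤ :+ k) y₃ y₂ y₁ :+ :ode m k y₂ y₁ y₀)))
    refl m k y₄ y₃ y₂ y₁ y₀ x₁

  Derivative-0 : ∀ m {k} → 2 ℕ.+ k ℕ.< 4 → Derivative m k ≡ 0ℤ
  Derivative-0 m {k} 2+k<4 = begin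
    Derivative m k
      ≡⟨ cong₂ (λ x₂ x₁ → derivative (+ m) (+ k) x₂ x₁ (coeff m (2 ℕ.+ k)) (coeff m (1 ℕ.+ k)) (coeff m k))
           (coeff-zero (suc m) 2+k<4) (coeff-zero (suc m) 1+k<4) ⟩
    derivative (+ m) (+ k) 0ℤ 0ℤ (coeff m (2 ℕ.+ k)) (coeff m (1 ℕ.+ k)) (coeff m k)
      ≡⟨ cong₂ (λ y₂ y₁ → derivative (+ m) (+ k) 0ℤ 0ℤ y₂ y₁ (coeff m k)) (coeff-zero m 2+k<4) (coeff-zero m 1+k<4) ⟩
    derivative (+ m) (+ k) 0ℤ 0ℤ 0ℤ 0ℤ (coeff m k)
      ≡⟨ cong (derivative (+ m) (+ k) 0ℤ 0ℤ 0ℤ 0ℤ) (coeff-zero m (ℕ.<-trans (ℕ.n<1+n k) 1+k<4)) ⟩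
    derivative (+ m) (+ k) 0ℤ 0ℤ 0ℤ 0ℤ 0ℤ
      ≡⟨ solve 2 (λ m k → let z = con 0ℤ in :derivative m k z z z z z := z) refl (+ m) (+ k) ⟩
    0ℤ ∎
    where
    open ≡-Reasoning
    1+k<4 : 1 ℕ.+ k ℕ.< 4
    1+k<4 = ℕ.<-trans (ℕ.n<1+n (1 ℕ.+ k)) 2+k<4

  -- m (1 - 2w) (φ^(m+1))′ = (m + 1) (1 - w)² (φ^m)′; both sides solve the same
  -- recurrence by Ode-zero.
  Derivative-zero : ∀ m k → Derivative m k ≡ 0ℤ
  Derivative-zero m 0 = Derivative-0 m 2<4
  Derivative-zero m 1 = Derivative-0 m 3<4
  Derivative-zero m (suc (suc k)) = begin
    Derivative m (2 ℕ.+ k)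
      ≡⟨ derivative-step (+ m) (+ k) (coeff m (4 ℕ.+ k)) (coeff m (3 ℕ.+ k)) (coeff m (2 ℕ.+ k)) (coeff m (1 ℕ.+ k)) (coeff m k)
           (coeff (suc m) (1 ℕ.+ k)) (coeff-rec m k) (coeff-rec m (1 ℕ.+ k)) (coeff-rec m (2 ℕ.+ k)) ⟩
    + 3 * Derivative m (1 ℕ.+ k) - + 2 * Derivative m k +
    (+ m * (Ode (suc m) (2 ℕ.+ k) - + 2 * Ode (suc m) (1 ℕ.+ k)) -
     (1ℤ + + m) * (Ode m (2 ℕ.+ k) - + 2 * Ode m (1 ℕ.+ k) + Ode m k))
      ≡⟨ vanish (Derivative-zero m (suc k)) (Derivative-zero m k) (Ode-zero (suc m) (2 ℕ.+ k)) (Ode-zero (suc m) (1 ℕ.+ k))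
           (Ode-zero m (2 ℕ.+ k)) (Ode-zero m (1 ℕ.+ k)) (Ode-zero m k) ⟩
    0ℤ ∎
    where
    open ≡-Reasoning
    vanish : ∀ {g₁ g₀ x₁ x₀ y₂ y₁ y₀} → g₁ ≡ 0ℤ → g₀ ≡ 0ℤ → x₁ ≡ 0ℤ → x₀ ≡ 0ℤ → y₂ ≡ 0ℤ → y₁ ≡ 0ℤ → y₀ ≡ 0ℤ →
             + 3 * g₁ - + 2 * g₀ + (+ m * (x₁ - + 2 * x₀) - (1ℤ + + m) * (y₂ - + 2 * y₁ + y₀)) ≡ 0ℤ
    vanish refl refl refl refl refl refl refl = solve 1 (λ m →
      con 0ℤ :+ (m :* con 0ℤ :- (con 1ℤ :+ m) :* con 0ℤ) := con 0ℤ) refl (+ m)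

  -- The coefficients (m - r) [w^r] φ^m of m φ^m - w (φ^m)′ satisfy, up to the factor
  -- m, the recurrence count-rec.
  weighted-rec : ∀ m e k → e ℕ.+ k ≡ 2 ℕ.+ m →
    + m * ((1ℤ + + e) * coeff (suc m) (2 ℕ.+ k) - + 2 * (+ 2 + + e) * coeff (suc m) (1 ℕ.+ k)) ≡
    (1ℤ + + m) * (+ e * coeff m (2 ℕ.+ k) - + 2 * (1ℤ + + e) * coeff m (1 ℕ.+ k) + (+ 2 + + e) * coeff m k)
  -- The indices 2 + k, 1 + k, k stand for the degrees r = m - e, m - e - 1, m - e - 2, so the
  -- weights m - r are e, 1 + e, 2 + e, and one more for φ^(m+1). The parts without derivatives
  -- cancel by `coeff-rec`.
  weighted-rec m e k e+k≡2+m = ℤ.i-j≡0⇒i≡j _ _ (trans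
    (identity (+ e) (+ k) (coeff m (2 ℕ.+ k)) (coeff m (1 ℕ.+ k)) (coeff m k) (coeff (suc m) (1 ℕ.+ k)) m≡ (coeff-rec m k))
    (cong ℤ.-_ (Derivative-zero m k)))
    where
    m≡ : + m ≡ + e + + k - + 2
    m≡ = trans (solve 1 (λ m → m := con (+ 2) :+ m :- con (+ 2)) refl (+ m)) (cong (λ i → + i - + 2) (sym e+k≡2+m))

    identity : ∀ {m} e k y₂ y₁ y₀ x₁ {x₂} → m ≡ e + k - + 2 → x₂ ≡ next x₁ y₂ y₁ y₀ →
      m * ((1ℤ + e) * x₂ - + 2 * (+ 2 + e) * x₁) -
      (1ℤ + m) * (e * y₂ - + 2 * (1ℤ + e) * y₁ + (+ 2 + e) * y₀) ≡ ℤ.- derivative m k x₂ x₁ y₂ y₁ y₀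
    identity e k y₂ y₁ y₀ x₁ refl refl = solve 6 (λ e k y₂ y₁ y₀ x₁ →
      let m = e :+ k :- con (+ 2) ; x₂ = :next x₁ y₂ y₁ y₀ in
      m :* ((con 1ℤ :+ e) :* x₂ :- con (+ 2) :* (con (+ 2) :+ e) :* x₁) :-
      (con 1ℤ :+ m) :* (e :* y₂ :- con (+ 2) :* (con 1ℤ :+ e) :* y₁ :+ (con (+ 2) :+ e) :* y₀) :=
      :- :derivative m k x₂ x₁ y₂ y₁ y₀) refl e k y₂ y₁ y₀ x₁

  count-recℤ : ∀ n e → + count (suc n) e ≡
    + shifted n e + + count n (suc e) + + 2 * + count (suc n) (suc e) - + 2 * + count n e
  count-recℤ n e = begin
    + count (suc n) e
      ≡⟨ solve 2 (λ x y → x := x :+ con (+ 2) :* y :- con (+ 2) :* y) refl (+ count (suc n) e) (+ count n e) ⟩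
    + count (suc n) e + + 2 * + count n e - + 2 * + count n e
      ≡⟨ cong (λ x → + count (suc n) e + x - + 2 * + count n e) (ℤ.pos-* 2 (count n e)) ⟨
    + (count (suc n) e ℕ.+ 2 ℕ.* count n e) - + 2 * + count n e
      ≡⟨ cong (λ x → + x - + 2 * + count n e) (count-rec n e) ⟩
    + (shifted n e ℕ.+ count n (suc e)) + + (2 ℕ.* count (suc n) (suc e)) - + 2 * + count n e
      ≡⟨ cong (λ x → + (shifted n e ℕ.+ count n (suc e)) + x - + 2 * + count n e) (ℤ.pos-* 2 (count (suc n) (suc e))) ⟩
    + shifted n e + + count n (suc e) + + 2 * + count (suc n) (suc e) - + 2 * + count n e ∎
    where open ≡-Reasoning

  vanish : ∀ n e {x} → n ℕ.< e → x ≡ 0ℤ → + suc n * + count n e ≡ + suc e * x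
  vanish n e n<e refl rewrite count≡0 n<e = trans (ℤ.*-zeroʳ (+ suc n)) (sym (ℤ.*-zeroʳ (+ suc e)))

  -- Lagrange inversion: w = z φ(w) has [z^m] w^j = j/m [w^(m-j)] φ^m, here with
  -- m = suc n and k = 4 + (m - j).
  lagrange : ∀ n j k → j ℕ.+ k ≡ 5 ℕ.+ n → + suc n * + shifted n j ≡ + j * coeff (suc n) k
  lagrange zero 0 _ refl = refl
  lagrange zero 1 _ refl = refl
  lagrange zero 2 _ refl = refl
  lagrange zero 3 _ refl = refl
  lagrange zero 4 _ refl = refl
  lagrange zero 5 _ refl = refl
  lagrange (suc n) zero k _ = ℤ.*-zeroʳ (+ suc (suc n))
  lagrange (suc n) (suc e) 0 eq = vanish (suc n) e (≤e eq) (coeff-zero (2 ℕ.+ n) (s≤s z≤n))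
    where
    ≤e : suc e ℕ.+ 0 ≡ 6 ℕ.+ n → suc n ℕ.< e
    ≤e eq = subst (suc n ℕ.<_) (trans (sym (ℕ.suc-injective eq)) (ℕ.+-identityʳ e)) (ℕ.m≤n+m (2 ℕ.+ n) 3)
  lagrange (suc n) (suc e) 1 eq = vanish (suc n) e (≤e eq) (coeff-zero (2 ℕ.+ n) (s≤s (s≤s z≤n)))
    where
    ≤e : suc e ℕ.+ 1 ≡ 6 ℕ.+ n → suc n ℕ.< e
    ≤e eq = subst (suc n ℕ.<_) (ℕ.suc-injective (ℕ.suc-injective (trans (sym eq) (ℕ.+-comm (suc e) 1)))) (ℕ.m≤n+m (2 ℕ.+ n) 2)
  -- Within a row the recurrence leads from e + 1 to e, so the inner induction is on k, starting
  -- where `count` vanishes. Cancelling `+ suc n` removes the extra factor in `weighted-rec`.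
  lagrange (suc n) (suc e) (suc (suc k)) eq = ℤ.*-cancelˡ-≡ (+ suc n) _ _ (combine (+ suc n) (+ e)
    (+ shifted n e) (+ count n e) (+ count n (suc e)) (+ count (suc n) (suc e))
    (coeff (2 ℕ.+ n) (2 ℕ.+ k)) (coeff (2 ℕ.+ n) (1 ℕ.+ k)) (coeff (1 ℕ.+ n) (2 ℕ.+ k)) (coeff (1 ℕ.+ n) (1 ℕ.+ k)) (coeff (1 ℕ.+ n) k)
    (lagrange n e (suc (suc k)) (ℕ.suc-injective eq))
    (lagrange n (suc e) (suc k) eq₁)
    (lagrange n (suc (suc e)) k eq₂)
    (lagrange (suc n) (suc (suc e)) (suc k) (cong suc eq₁))
    (weighted-rec (suc n) e k (ℕ.suc-injective (ℕ.suc-injective eq₂)))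
    (count-recℤ n e))
    where
    eq₁ : suc e ℕ.+ suc k ≡ 5 ℕ.+ n
    eq₁ = trans (sym (ℕ.+-suc e (suc k))) (ℕ.suc-injective eq)
    eq₂ : suc (suc e) ℕ.+ k ≡ 5 ℕ.+ n
    eq₂ = trans (sym (ℕ.+-suc (suc e) k)) eq₁
    combine : ∀ m e s c₀ c₁ v₊ x₂ x₁ y₂ y₁ y₀ {v} →
      m * s ≡ e * y₂ → m * c₀ ≡ (1ℤ + e) * y₁ → m * c₁ ≡ (+ 2 + e) * y₀ →
      (1ℤ + m) * v₊ ≡ (+ 2 + e) * x₁ →
      m * ((1ℤ + e) * x₂ - + 2 * (+ 2 + e) * x₁) ≡ (1ℤ + m) * (e * y₂ - + 2 * (1ℤ + e) * y₁ + (+ 2 + e) * y₀) →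
      v ≡ s + c₁ + + 2 * v₊ - + 2 * c₀ →
      m * ((1ℤ + m) * v) ≡ m * ((1ℤ + e) * x₂)
    combine m e s c₀ c₁ v₊ x₂ x₁ y₂ y₁ y₀ hs h₀ h₁ h₊ hw refl = begin
      m * ((1ℤ + m) * (s + c₁ + + 2 * v₊ - + 2 * c₀))
        ≡⟨ solve 5 (λ m s c₀ c₁ v₊ → m :* ((con 1ℤ :+ m) :* (s :+ c₁ :+ con (+ 2) :* v₊ :- con (+ 2) :* c₀)) :=
             (con 1ℤ :+ m) :* (m :* s :- con (+ 2) :* (m :* c₀) :+ m :* c₁) :+ con (+ 2) :* m :* ((con 1ℤ :+ m) :* v₊))
             refl m s c₀ c₁ v₊ ⟩
      (1ℤ + m) * (m * s - + 2 * (m * c₀) + m * c₁) + + 2 * m * ((1ℤ + m) * v₊)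
        ≡⟨ cong₂ (λ x y → (1ℤ + m) * x + + 2 * m * y) (cong₂ _+_ (cong₂ (λ x y → x - + 2 * y) hs h₀) h₁) h₊ ⟩
      (1ℤ + m) * (e * y₂ - + 2 * ((1ℤ + e) * y₁) + (+ 2 + e) * y₀) + + 2 * m * ((+ 2 + e) * x₁)
        ≡⟨ cong (λ x → (1ℤ + m) * (e * y₂ - x + (+ 2 + e) * y₀) + + 2 * m * ((+ 2 + e) * x₁)) (ℤ.*-assoc (+ 2) (1ℤ + e) y₁) ⟨
      (1ℤ + m) * (e * y₂ - + 2 * (1ℤ + e) * y₁ + (+ 2 + e) * y₀) + + 2 * m * ((+ 2 + e) * x₁)
        ≡⟨ cong (_+ + 2 * m * ((+ 2 + e) * x₁)) hw ⟨
      m * ((1ℤ + e) * x₂ - + 2 * (+ 2 + e) * x₁) + + 2 * m * ((+ 2 + e) * x₁)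
        ≡⟨ solve 4 (λ m e x₂ x₁ → m :* ((con 1ℤ :+ e) :* x₂ :- con (+ 2) :* (con (+ 2) :+ e) :* x₁) :+
             con (+ 2) :* m :* ((con (+ 2) :+ e) :* x₁) := m :* ((con 1ℤ :+ e) :* x₂)) refl m e x₂ x₁ ⟩
      m * ((1ℤ + e) * x₂) ∎
      where open ≡-Reasoning

open LagrangeInversion using (geometric; geometric-zero; power; power-zero; lagrange)

open import Data.Nat.Base using (_+_; _*_; _∸_; _^_; _≤_; _<_; ⌈_/2⌉; _!; NonZero)

-- The binomial expansion of the powers of φ

geometric-cong : ∀ {f g} → (∀ k → f k ≡ g k) → ∀ k → geometric f k ≡ geometric g k
geometric-cong f≗g zero          = refl
geometric-cong f≗g (suc zero)    = refl
geometric-cong f≗g (suc (suc k)) = cong₂ (λ x y → 2 * x + y) (geometric-cong f≗g (suc k)) (f≗g k)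

geometric-+ : ∀ f g k → geometric (λ k → f k + g k) k ≡ geometric f k + geometric g k
geometric-+ f g zero          = refl
geometric-+ f g (suc zero)    = refl
geometric-+ f g (suc (suc k)) = trans (cong (λ x → 2 * x + (f k + g k)) (geometric-+ f g (suc k)))
  (solve 4 (λ x y z w → con 2 :* (x :+ y) :+ (z :+ w) := con 2 :* x :+ z :+ (con 2 :* y :+ w)) refl
    (geometric f (suc k)) (geometric g (suc k)) (f k) (g k))
  where open ℕ.+-*-Solver

geometric-* : ∀ c f k → geometric (λ k → c * f k) k ≡ c * geometric f k
geometric-* c f zero          = sym (ℕ.*-zeroʳ c)
geometric-* c f (suc zero)    = sym (ℕ.*-zeroʳ c)
geometric-* c f (suc (suc k)) = trans (cong (λ x → 2 * x + c * f k) (geometric-* c f (suc k)))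
  (solve 3 (λ c x y → con 2 :* (c :* x) :+ c :* y := c :* (con 2 :* x :+ y)) refl c (geometric f (suc k)) (f k))
  where open ℕ.+-*-Solver

geometric-0 : ∀ k → geometric (λ _ → 0) k ≡ 0
geometric-0 zero          = refl
geometric-0 (suc zero)    = refl
geometric-0 (suc (suc k)) = cong (λ x → 2 * x + 0) (geometric-0 (suc k))

geometric-Σ< : ∀ n (f : ℕ → ℕ → ℕ) k → geometric (λ k → Σ< n λ t → f t k) k ≡ Σ< n λ t → geometric (f t) k
geometric-Σ< zero    f k = geometric-0 k
geometric-Σ< (suc n) f k = trans (geometric-+ (f 0) _ k) (cong (λ x → geometric (f 0) k + x) (geometric-Σ< n (f ∘ suc) k))

Σ<-last : ∀ n f → Σ< (suc n) f ≡ Σ< n f + f n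
Σ<-last zero    f = ℕ.+-comm (f 0) 0
Σ<-last (suc n) f = trans (cong (λ x → f 0 + x) (Σ<-last n (f ∘ suc))) (sym (ℕ.+-assoc (f 0) _ _))

Σ<-split : ∀ m n f → Σ< (m + n) f ≡ Σ< m f + Σ< n (λ t → f (m + t))
Σ<-split zero    n f = refl
Σ<-split (suc m) n f = trans (cong (λ x → f 0 + x) (Σ<-split m n (f ∘ suc))) (sym (ℕ.+-assoc (f 0) _ _))

Σ<-zero-< : ∀ n {f : ℕ → ℕ} → (∀ {t} → t < n → f t ≡ 0) → Σ< n f ≡ 0
Σ<-zero-< zero    f≡0 = refl
Σ<-zero-< (suc n) f≡0 = cong₂ _+_ (f≡0 (s≤s z≤n)) (Σ<-zero-< n (f≡0 ∘ s≤s))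

iterate : ℕ → ℕ → ℕ
iterate zero    = δ 4
iterate (suc i) = geometric (iterate i)

-- The binomial theorem for the operator 1 + `geometric`, applied m times to `δ 4`. The terms are
-- indexed by the number of factors 1, which is the k of the final formula.
power-expand : ∀ m k → power m k ≡ Σ< (suc m) λ t → (m C t) * iterate (m ∸ t) k
power-expand zero k = solve 1 (λ x → x := con 1 :* x :+ con 0) refl (δ 4 k)
  where open ℕ.+-*-Solver
power-expand (suc m) k = begin
  power m k + geometric (power m) k
    ≡⟨ cong₂ _+_ (power-expand m k) (geometric-cong (power-expand m) k) ⟩
  Σ< (suc m) old + geometric (λ k → Σ< (suc m) λ t → (m C t) * iterate (m ∸ t) k) k
    ≡⟨ cong (λ x → Σ< (suc m) old + x) (geometric-Σ< (suc m) (λ t k → (m C t) * iterate (m ∸ t) k) k) ⟩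
  Σ< (suc m) old + Σ< (suc m) (λ t → geometric (λ k → (m C t) * iterate (m ∸ t) k) k)
    ≡⟨ cong (λ x → Σ< (suc m) old + x) (Σ<-cong (suc m) (λ t → geometric-* (m C t) (iterate (m ∸ t)) k)) ⟩
  Σ< (suc m) old + (1 * iterate (suc m) k + Σ< m (λ t → (m C suc t) * iterate (suc (m ∸ suc t)) k))
    ≡⟨ cong (λ x → Σ< (suc m) old + (1 * iterate (suc m) k + x)) (Σ<-cong m shift) ⟩
  Σ< (suc m) old + (1 * iterate (suc m) k + Σ< m new)
    -- The vanishing term `new m` is appended, so that both sums have length `suc m` and Pascal's
    -- rule applies term by term.
    ≡⟨ cong (λ x → Σ< (suc m) old + (1 * iterate (suc m) k + x)) (ℕ.+-identityʳ (Σ< m new)) ⟨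
  Σ< (suc m) old + (1 * iterate (suc m) k + (Σ< m new + 0))
    ≡⟨ cong (λ x → Σ< (suc m) old + (1 * iterate (suc m) k + (Σ< m new + x)))
         (cong (_* iterate (m ∸ m) k) (k>n⇒nCk≡0 (ℕ.n<1+n m))) ⟨
  Σ< (suc m) old + (1 * iterate (suc m) k + (Σ< m new + new m))
    ≡⟨ cong (λ x → Σ< (suc m) old + (1 * iterate (suc m) k + x)) (Σ<-last m new) ⟨
  Σ< (suc m) old + (1 * iterate (suc m) k + Σ< (suc m) new)
    ≡⟨ solve 3 (λ x y z → x :+ (y :+ z) := y :+ (x :+ z)) refl (Σ< (suc m) old) (1 * iterate (suc m) k) (Σ< (suc m) new) ⟩
  1 * iterate (suc m) k + (Σ< (suc m) old + Σ< (suc m) new)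
    ≡⟨ cong (λ x → 1 * iterate (suc m) k + x) (Σ<-+ (suc m) old new) ⟨
  1 * iterate (suc m) k + Σ< (suc m) (λ t → old t + new t)
    ≡⟨ cong (λ x → 1 * iterate (suc m) k + x) (Σ<-cong (suc m) (λ t →
         trans (sym (ℕ.*-distribʳ-+ (iterate (m ∸ t) k) (m C t) (m C suc t)))
               (cong (_* iterate (m ∸ t) k) (nCk+nC[k+1]≡[n+1]C[k+1] m t)))) ⟩
  1 * iterate (suc m) k + Σ< (suc m) (λ t → (suc m C suc t) * iterate (m ∸ t) k) ∎
  where
  open ≡-Reasoning
  open ℕ.+-*-Solver
  old new : ℕ → ℕ
  old t = (m C t) * iterate (m ∸ t) k
  new t = (m C suc t) * iterate (m ∸ t) k
  -- The exponents agree only for t < m; beyond that truncated subtraction spoils them, but the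
  -- binomial coefficient is 0.
  shift : ∀ t → (m C suc t) * iterate (suc (m ∸ suc t)) k ≡ new t
  shift t with suc t ℕ.≤? m
  ... | yes t<m = cong (λ i → (m C suc t) * iterate i k) (sym (ℕ.+-∸-assoc 1 t<m))
  ... | no  t≮m rewrite k>n⇒nCk≡0 (ℕ.≰⇒> t≮m) = refl

iterate-zero : ∀ i {k} → k < i * 2 + 4 → iterate i k ≡ 0
iterate-zero zero    = power-zero 0
iterate-zero (suc i) = geometric-zero (iterate-zero i)

-- The binomial coefficient of i + s - 1 over s, where i = s = 0 gives 1.
multichoose : ℕ → ℕ → ℕ
multichoose zero    zero    = 1
multichoose zero    (suc s) = 0
multichoose (suc i) s       = (i + s) C s

multichoose-rec : ∀ i s → multichoose (suc i) (suc s) ≡ multichoose (suc i) s + multichoose i (suc s)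
multichoose-rec zero    s = trans (nCn≡1 (suc s)) (sym (trans (ℕ.+-identityʳ (s C s)) (nCn≡1 s)))
multichoose-rec (suc i) s = sym (trans (cong (λ x → (suc i + s) C s + (x C suc s)) (ℕ.+-suc i s))
  (trans (nCk+nC[k+1]≡[n+1]C[k+1] (suc i + s) s) (cong (_C suc s) (cong suc (sym (ℕ.+-suc i s))))))

multichoose-0 : ∀ i → multichoose i 0 ≡ 1
multichoose-0 zero    = refl
multichoose-0 (suc i) = refl

-- `iterate i` is w^(2i) / (1 - 2w)^i, shifted by 4; its recurrence is the Pascal-type rule
-- `multichoose-rec` scaled by powers of two.
iterate-closed : ∀ i s → iterate i (i * 2 + 4 + s) ≡ multichoose i s * 2 ^ s
iterate-closed zero    zero    = refl
iterate-closed zero    (suc s) = refl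
iterate-closed (suc i) zero    = begin
  2 * geometric (iterate i) (suc (i * 2 + 4 + 0)) + iterate i (i * 2 + 4 + 0)
    ≡⟨ cong₂ (λ x y → 2 * x + y)
         (iterate-zero (suc i) (s≤s (s≤s (ℕ.≤-reflexive (ℕ.+-identityʳ (i * 2 + 4))))))
         (trans (iterate-closed i 0) (cong (_* 1) (multichoose-0 i))) ⟩
  1
    ≡⟨ cong (_* 1) (multichoose-0 (suc i)) ⟨
  multichoose (suc i) 0 * 1 ∎
  where open ≡-Reasoning
iterate-closed (suc i) (suc s) = begin
  2 * geometric (iterate i) (suc (i * 2 + 4 + suc s)) + iterate i (i * 2 + 4 + suc s)
    ≡⟨ cong (λ k → 2 * geometric (iterate i) (suc k) + iterate i (i * 2 + 4 + suc s)) (ℕ.+-suc (i * 2 + 4) s) ⟩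
  2 * iterate (suc i) (suc i * 2 + 4 + s) + iterate i (i * 2 + 4 + suc s)
    ≡⟨ cong₂ (λ x y → 2 * x + y) (iterate-closed (suc i) s) (iterate-closed i (suc s)) ⟩
  2 * (multichoose (suc i) s * 2 ^ s) + multichoose i (suc s) * (2 * 2 ^ s)
    ≡⟨ solve 3 (λ x y p → con 2 :* (x :* p) :+ y :* (con 2 :* p) := (x :+ y) :* (con 2 :* p)) refl
         (multichoose (suc i) s) (multichoose i (suc s)) (2 ^ s) ⟩
  (multichoose (suc i) s + multichoose i (suc s)) * 2 ^ suc s
    ≡⟨ cong (_* 2 ^ suc s) (multichoose-rec i s) ⟨
  multichoose (suc i) (suc s) * 2 ^ suc s ∎
  where
  open ≡-Reasoning
  open ℕ.+-*-Solver

-- Generalized binomial coefficients and rational numbers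

-- The definition splits off the last factor, whereas induction on the upper argument needs the
-- first one.
fallingFactorial-suc : ∀ x s → fallingFactorial (1ℤ ℤ.+ x) (suc s) ≡ (1ℤ ℤ.+ x) ℤ.* fallingFactorial x s
fallingFactorial-suc x zero = solve 1 (λ x → con 1ℤ :* (con 1ℤ :+ x :- con 0ℤ) := (con 1ℤ :+ x) :* con 1ℤ) refl x
  where open ℤ.+-*-Solver
fallingFactorial-suc x (suc s) = trans
  (cong (ℤ._* (1ℤ ℤ.+ x ℤ.- (1ℤ ℤ.+ + s))) (fallingFactorial-suc x s))
  (solve 3 (λ x s f → (con 1ℤ :+ x) :* f :* (con 1ℤ :+ x :- (con 1ℤ :+ s)) := (con 1ℤ :+ x) :* (f :* (x :- s))) refl
    x (+ s) (fallingFactorial x s))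
  where open ℤ.+-*-Solver

fallingFactorial-0 : ∀ s → fallingFactorial 0ℤ (suc s) ≡ 0ℤ
fallingFactorial-0 zero    = refl
fallingFactorial-0 (suc s) = cong (ℤ._* (0ℤ ℤ.- + suc s)) (fallingFactorial-0 s)

fallingFactorial-C : ∀ n s → fallingFactorial (+ n) s ≡ + (n C s) ℤ.* + (s !)
fallingFactorial-C n       zero    = refl
fallingFactorial-C zero    (suc s) = fallingFactorial-0 s
fallingFactorial-C (suc n) (suc s) = begin
  fallingFactorial (+ suc n) (suc s)
    ≡⟨ fallingFactorial-suc (+ n) s ⟩
  (1ℤ ℤ.+ + n) ℤ.* fallingFactorial (+ n) s
    -- 1 + n is split into (n - s) + (1 + s), one summand for each term of Pascal's rule.
    ≡⟨ solve 3 (λ n s f → (con 1ℤ :+ n) :* f := f :* (n :- s) :+ (con 1ℤ :+ s) :* f) refl (+ n) (+ s) (fallingFactorial (+ n) s) ⟩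
  fallingFactorial (+ n) (suc s) ℤ.+ + suc s ℤ.* fallingFactorial (+ n) s
    ≡⟨ cong₂ (λ x y → x ℤ.+ + suc s ℤ.* y) (fallingFactorial-C n (suc s)) (fallingFactorial-C n s) ⟩
  + (n C suc s) ℤ.* + (suc s * s !) ℤ.+ + suc s ℤ.* (+ (n C s) ℤ.* + (s !))
    ≡⟨ cong (λ x → + (n C suc s) ℤ.* x ℤ.+ + suc s ℤ.* (+ (n C s) ℤ.* + (s !))) (ℤ.pos-* (suc s) (s !)) ⟩
  + (n C suc s) ℤ.* (+ suc s ℤ.* + (s !)) ℤ.+ + suc s ℤ.* (+ (n C s) ℤ.* + (s !))
    ≡⟨ solve 4 (λ c d s f → c :* (s :* f) :+ s :* (d :* f) := (d :+ c) :* (s :* f)) refl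
         (+ (n C suc s)) (+ (n C s)) (+ suc s) (+ (s !)) ⟩
  + ((n C s) + (n C suc s)) ℤ.* (+ suc s ℤ.* + (s !))
    ≡⟨ cong₂ (λ x y → + x ℤ.* y) (nCk+nC[k+1]≡[n+1]C[k+1] n s) (sym (ℤ.pos-* (suc s) (s !))) ⟩
  + (suc n C suc s) ℤ.* + (suc s !) ∎
  where
  open ≡-Reasoning
  open ℤ.+-*-Solver

/-cancel : ∀ {z} c d .{{_ : NonZero d}} → z ≡ + c ℤ.* + d → z ℚ./ d ≡ fromℕ/1 c
/-cancel {z} c (suc d) z≡c*d = ℚ.fromℚᵘ-cong {mkℚᵘ z d} {mkℚᵘ (+ c) 0}
  (*≡* (trans (ℤ.*-identityʳ z) z≡c*d))

fromℕ/1-+ : ∀ m n → fromℕ/1 (m + n) ≡ fromℕ/1 m ℚ.+ fromℕ/1 n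
fromℕ/1-+ m n = ℚ.toℚᵘ-injective (begin-equality
  toℚᵘ (fromℕ/1 (m + n))                    ≃⟨ ℚ.toℚᵘ-fromℚᵘ (mkℚᵘ (+ (m + n)) 0) ⟩
  mkℚᵘ (+ (m + n)) 0                        ≃⟨ *≡* (cong (ℤ._* 1ℤ) (cong₂ ℤ._+_ (sym (ℤ.*-identityʳ (+ m))) (sym (ℤ.*-identityʳ (+ n))))) ⟩
  mkℚᵘ (+ m) 0 ℚᵘ.+ mkℚᵘ (+ n) 0            ≃⟨ ℚᵘ.+-cong (ℚ.toℚᵘ-fromℚᵘ (mkℚᵘ (+ m) 0)) (ℚ.toℚᵘ-fromℚᵘ (mkℚᵘ (+ n) 0)) ⟨
  toℚᵘ (fromℕ/1 m) ℚᵘ.+ toℚᵘ (fromℕ/1 n)    ≃⟨ ℚ.toℚᵘ-homo-+ (fromℕ/1 m) (fromℕ/1 n) ⟨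
  toℚᵘ (fromℕ/1 m ℚ.+ fromℕ/1 n)            ∎)
  where open ℚᵘ.≤-Reasoning

/-* : ∀ p d q → (p ℚ./ suc d) ℚ.* (q ℚ./ 1) ≡ (p ℤ.* q) ℚ./ suc d
/-* p d q = ℚ.toℚᵘ-injective (begin-equality
  toℚᵘ ((p ℚ./ suc d) ℚ.* (q ℚ./ 1))           ≃⟨ ℚ.toℚᵘ-homo-* (p ℚ./ suc d) (q ℚ./ 1) ⟩
  toℚᵘ (p ℚ./ suc d) ℚᵘ.* toℚᵘ (q ℚ./ 1)       ≃⟨ ℚᵘ.*-cong (ℚ.toℚᵘ-fromℚᵘ (mkℚᵘ p d)) (ℚ.toℚᵘ-fromℚᵘ (mkℚᵘ q 0)) ⟩
  mkℚᵘ p d ℚᵘ.* mkℚᵘ q 0                       ≃⟨ *≡* (cong ((p ℤ.* q) ℤ.*_) (cong +_ (sym (ℕ.*-identityʳ (suc d))))) ⟩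
  mkℚᵘ (p ℤ.* q) d                             ≃⟨ ℚ.toℚᵘ-fromℚᵘ (mkℚᵘ (p ℤ.* q) d) ⟨
  toℚᵘ ((p ℤ.* q) ℚ./ suc d)                   ∎)
  where open ℚᵘ.≤-Reasoning

fromℕ/1-* : ∀ m n → fromℕ/1 m ℚ.* fromℕ/1 n ≡ fromℕ/1 (m * n)
fromℕ/1-* m n = trans (/-* (+ m) 0 (+ n)) (cong (ℚ._/ 1) (sym (ℤ.pos-* m n)))

sum-fromℕ/1 : ∀ b {f : ℕ → ℚ} {g : ℕ → ℕ} → (∀ {t} → t < b → f t ≡ fromℕ/1 (g t)) →
              foldr ℚ._+_ 0ℚ (applyUpTo f b) ≡ fromℕ/1 (Σ< b g)
sum-fromℕ/1 zero    f≡g = refl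
sum-fromℕ/1 (suc b) {f} {g} f≡g = trans
  (cong₂ ℚ._+_ (f≡g (s≤s z≤n)) (sum-fromℕ/1 b (f≡g ∘ s≤s)))
  (sym (fromℕ/1-+ (g 0) (Σ< b (g ∘ suc))))

binomial-multichoose : ∀ i s {x} → 1ℤ ℤ.+ x ≡ + (i + s) → binomial x s ≡ fromℕ/1 (multichoose i s)
binomial-multichoose i s {x} 1+x≡i+s = /-cancel (multichoose i s) (s !) {{s ℕ.!≢0}} (numerator i s x≡)
  where
  open ≡-Reasoning
  x≡ : x ≡ + (i + s) ℤ.- 1ℤ
  x≡ = trans (solve 1 (λ x → x := con 1ℤ :+ x :- con 1ℤ) refl x) (cong (ℤ._- 1ℤ) 1+x≡i+s)
    where open ℤ.+-*-Solver
  numerator : ∀ i s {x} → x ≡ + (i + s) ℤ.- 1ℤ → fallingFactorial x s ≡ + multichoose i s ℤ.* + (s !)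
  -- Here x = -1, the generalized coefficient that equals 1.
  numerator zero    zero    refl = refl
  numerator zero    (suc s) refl = trans (fallingFactorial-C s (suc s))
    (cong (λ c → + c ℤ.* + (suc s !)) (k>n⇒nCk≡0 (ℕ.n<1+n s)))
  numerator (suc i) s       refl = fallingFactorial-C (i + s) s

-- The sum in the formula

k<⌈n/2⌉⇒2k<n : ∀ {k n} → k < ⌈ n /2⌉ → 2 * k < n
k<⌈n/2⌉⇒2k<n {k} {n} k<⌈n/2⌉ = ℕ.≰⇒> λ n≤2k → ℕ.<⇒≱ k<⌈n/2⌉ (subst (⌈ n /2⌉ ≤_)
  (sym (ℕ.n≡⌈n+n/2⌉ k)) (ℕ.⌈n/2⌉-mono (subst (n ≤_) (cong (λ x → k + x) (ℕ.+-identityʳ k)) n≤2k)))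

⌈n/2⌉≤k⇒n≤2k : ∀ {k n} → ⌈ n /2⌉ ≤ k → n ≤ 2 * k
⌈n/2⌉≤k⇒n≤2k {k} {n} ⌈n/2⌉≤k = subst₂ _≤_ (ℕ.⌊n/2⌋+⌈n/2⌉≡n n) (cong (λ x → k + x) (sym (ℕ.+-identityʳ k)))
  (ℕ.+-mono-≤ (ℕ.≤-trans (ℕ.⌊n/2⌋≤⌈n/2⌉ n) ⌈n/2⌉≤k) ⌈n/2⌉≤k)

module _ (n j r : ℕ) (j+r≡1+n : j + r ≡ suc n) where

  private
    N = n + j + 1
    a₀ = ⌈ N /2⌉

    coefficient : ℕ → ℕ
    coefficient k = (suc n C k) * iterate (suc n ∸ k) (4 + r)

  N+r≡ : N + r ≡ 2 * suc n
  N+r≡ = trans (solve 3 (λ n j r → n :+ j :+ con 1 :+ r := con 1 :+ n :+ (j :+ r)) refl n j r)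
    (trans (cong (λ x → suc n + x) j+r≡1+n) (cong (λ x → suc n + x) (sym (ℕ.+-identityʳ (suc n)))))
    where open ℕ.+-*-Solver

  -- In the paper's notation k = n + 1 - i, and the lower index of the second
  -- binomial coefficient is s = r - 2i.
  module _ {k i} (i+k≡1+n : i + k ≡ suc n) where

    N+r≡2i+2k : N + r ≡ i * 2 + 2 * k
    N+r≡2i+2k = trans N+r≡ (trans (cong (2 *_) (sym i+k≡1+n))
      (solve 2 (λ i k → con 2 :* (i :+ k) := i :* con 2 :+ con 2 :* k) refl i k))
      where open ℕ.+-*-Solver

    -- Below the summation range r < 2i, whereas the series behind `iterate i` starts with w^(2i).
    iterate-below : 2 * k < N → iterate i (4 + r) ≡ 0
    iterate-below 2k<N = iterate-zero i (subst (4 + r <_) (ℕ.+-comm 4 (i * 2)) (ℕ.+-monoʳ-< 4 r<2i))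
      where
      r<2i : r < i * 2
      r<2i = ℕ.+-cancelˡ-< N r (i * 2) (subst₂ _<_ (sym N+r≡2i+2k) (ℕ.+-comm (i * 2) N) (ℕ.+-monoʳ-< (i * 2) 2k<N))

    module _ (N≤2k : N ≤ 2 * k) where

      s = 2 * k ∸ N

      r≡2i+s : r ≡ i * 2 + s
      r≡2i+s = ℕ.+-cancelˡ-≡ N r (i * 2 + s) (trans N+r≡2i+2k (trans (cong (λ x → i * 2 + x) (sym (ℕ.m+[n∸m]≡n N≤2k)))
        (solve 3 (λ x y z → x :+ (y :+ z) := y :+ (x :+ z)) refl (i * 2) N s)))
        where open ℕ.+-*-Solver

      k≡i+s+j : k ≡ i + s + j
      k≡i+s+j = ℕ.+-cancelˡ-≡ i k (i + s + j) (trans i+k≡1+n (trans (sym j+r≡1+n) (trans (cong (λ x → j + x) r≡2i+s)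
        (solve 3 (λ i j s → j :+ (i :* con 2 :+ s) := i :+ (i :+ s :+ j)) refl i j s))))
        where open ℕ.+-*-Solver

      upper : 1ℤ ℤ.+ (+ k ℤ.- + j ℤ.- 1ℤ) ≡ + (i + s)
      upper = trans (cong (λ k → 1ℤ ℤ.+ (+ k ℤ.- + j ℤ.- 1ℤ)) k≡i+s+j)
        (solve 2 (λ x j → con 1ℤ :+ (x :+ j :- j :- con 1ℤ) := x) refl (+ (i + s)) (+ j))
        where open ℤ.+-*-Solver

      term-closed : fromℕ/1 (suc n C k) ℚ.* binomial (+ k ℤ.- + j ℤ.- 1ℤ) s ℚ.* fromℕ/1 (2 ^ s) ≡
                    fromℕ/1 ((suc n C k) * iterate i (4 + r))
      term-closed = begin
        fromℕ/1 (suc n C k) ℚ.* binomial (+ k ℤ.- + j ℤ.- 1ℤ) s ℚ.* fromℕ/1 (2 ^ s)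
          ≡⟨ cong (λ b → fromℕ/1 (suc n C k) ℚ.* b ℚ.* fromℕ/1 (2 ^ s)) (binomial-multichoose i s upper) ⟩
        fromℕ/1 (suc n C k) ℚ.* fromℕ/1 (multichoose i s) ℚ.* fromℕ/1 (2 ^ s)
          ≡⟨ cong (ℚ._* fromℕ/1 (2 ^ s)) (fromℕ/1-* (suc n C k) (multichoose i s)) ⟩
        fromℕ/1 ((suc n C k) * multichoose i s) ℚ.* fromℕ/1 (2 ^ s)
          ≡⟨ fromℕ/1-* ((suc n C k) * multichoose i s) (2 ^ s) ⟩
        fromℕ/1 ((suc n C k) * multichoose i s * 2 ^ s)
          ≡⟨ cong fromℕ/1 (ℕ.*-assoc (suc n C k) (multichoose i s) (2 ^ s)) ⟩
        fromℕ/1 ((suc n C k) * (multichoose i s * 2 ^ s))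
          ≡⟨ cong (λ x → fromℕ/1 ((suc n C k) * x)) (iterate-closed i s) ⟨
        fromℕ/1 ((suc n C k) * iterate i (i * 2 + 4 + s))
          ≡⟨ cong (λ x → fromℕ/1 ((suc n C k) * iterate i x))
               (trans (cong (_+ s) (ℕ.+-comm (i * 2) 4)) (cong (λ x → 4 + x) (sym r≡2i+s))) ⟩
        fromℕ/1 ((suc n C k) * iterate i (4 + r)) ∎
        where open ≡-Reasoning

  a₀≤1+n : a₀ ≤ suc n
  a₀≤1+n = ℕ.≮⇒≥ λ 1+n<a₀ → ℕ.<⇒≱ (k<⌈n/2⌉⇒2k<n 1+n<a₀) (subst (N ≤_) N+r≡ (ℕ.m≤m+n N r))

  sum-closed : ∑[ a₀ ⋯ suc n ] (λ k →
                 fromℕ/1 (suc n C k) ℚ.* binomial (+ k ℤ.- + j ℤ.- 1ℤ) (2 * k ∸ N) ℚ.* fromℕ/1 (2 ^ (2 * k ∸ N))) ≡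
               fromℕ/1 (power (suc n) (4 + r))
  sum-closed = trans (sum-fromℕ/1 b (λ {t} t<b → term-closed {a₀ + t} {suc n ∸ (a₀ + t)}
      (ℕ.m∸n+n≡m (≤1+n t<b)) (⌈n/2⌉≤k⇒n≤2k (ℕ.m≤m+n a₀ t))))
    (cong fromℕ/1 (begin
      Σ< b (λ t → coefficient (a₀ + t))
        -- The sum is continued down to k = 0 by vanishing terms, which makes it the full binomial
        -- expansion.
        ≡⟨ cong (_+ Σ< b (λ t → coefficient (a₀ + t))) (Σ<-zero-< a₀ {coefficient} below) ⟨
      Σ< a₀ coefficient + Σ< b (λ t → coefficient (a₀ + t))
        ≡⟨ Σ<-split a₀ b coefficient ⟨
      Σ< (a₀ + b) coefficient
        ≡⟨ cong (λ x → Σ< x coefficient) (ℕ.m+[n∸m]≡n (ℕ.m≤n⇒m≤1+n a₀≤1+n)) ⟩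
      Σ< (2 + n) coefficient
        ≡⟨ power-expand (suc n) (4 + r) ⟨
      power (suc n) (4 + r) ∎))
    where
    open ≡-Reasoning
    b = 2 + n ∸ a₀
    ≤1+n : ∀ {t} → t < b → a₀ + t ≤ suc n
    ≤1+n {t} t<b = ℕ.≤-pred (subst (a₀ + t <_) (ℕ.m+[n∸m]≡n (ℕ.m≤n⇒m≤1+n a₀≤1+n)) (ℕ.+-monoʳ-< a₀ t<b))
    below : ∀ {k} → k < a₀ → coefficient k ≡ 0
    below {k} k<a₀ = trans (cong ((suc n C k) *_)
      (iterate-below {k} (ℕ.m∸n+n≡m (ℕ.<⇒≤ (ℕ.<-≤-trans k<a₀ a₀≤1+n))) (k<⌈n/2⌉⇒2k<n k<a₀)))
      (ℕ.*-zeroʳ (suc n C k))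

scale-closed : ∀ n j v P → + suc n ℤ.* + v ≡ + j ℤ.* + P → fromℕ/1 v ≡ (+ j ℚ./ suc n) ℚ.* fromℕ/1 P
scale-closed n j v P eq = sym (trans (/-* (+ j) n (+ P)) (/-cancel v (suc n) (trans (sym eq) (ℤ.*-comm (+ suc n) (+ v)))))

-- From codes to drawings

module _ {c ℓ₁ ℓ₂ ℓ₃} (F : OrderedField c ℓ₁ ℓ₂ ℓ₃) {n} (p : Fin (suc n) → Plane.Point F)
         (convex : Plane.Convex F p) where
  open Geometry F
  open Plane F using (Visible; HasIsolationDegree; NonCrossingOfDegree)

  outer⇔visible : ∀ (P : Partition n) i →
    Outer (_∈ₗ blocks P) i ⇔ (Isolated P i × Visible P (p ∘ inject₁) (p (inject₁ i)) (p (fromℕ n)))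
  outer⇔visible P i = mk⇔
    (λ outer → proj₁ outer , outer⇒visible p convex P outer)
    (λ (isolated , visible) → visible⇒outer p convex P isolated visible)

  code⇒partition : ∀ {d} → Code n d → Σ (Partition n) λ P → NonCrossing P × HasIsolationDegree p P d
  code⇒partition c = partition c , partition-nonCrossing c , singletons c ,
    (λ i → ⇔.trans (singletons-outer c i) (outer⇔visible (partition c) i)) , ∣singletons∣ c

  -- `code-surjective` leaves the degree of the code open. Code and partition have the same outer
  -- singletons, and for P these are the visible isolated vertices, so the two degrees agree.
  partition⇒code : ∀ {d} (P : Partition n) → NonCrossing P → HasIsolationDegree p P d →
    ∃ λ (c : Code n d) → ∀ B → B ∈ₗ blocks (partition c) ⇔ B ∈ₗ blocks P
  partition⇒code P P-nc (S , S-visible , ∣S∣≡d) =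
    let d′ , c , c∼P = code-surjective (isNonCrossingPartition P P-nc)
        singletons≡S = singletons-unique c∼P (singletons-outer c)
          (λ i → ⇔.trans (S-visible i) (⇔.sym (outer⇔visible P i)))
    in retarget (trans (sym (∣singletons∣ c)) (trans (cong ∣_∣ singletons≡S) ∣S∣≡d)) c c∼P
    where
    retarget : ∀ {d d′} → d′ ≡ d → (c : Code n d′) → (∀ B → B ∈ₗ blocks (partition c) ⇔ B ∈ₗ blocks P) →
               ∃ λ (c : Code n d) → ∀ B → B ∈ₗ blocks (partition c) ⇔ B ∈ₗ blocks P
    retarget refl c c∼P = c , c∼P

  nonCrossing-cardinality : ∀ d → HasCardinality (NonCrossingOfDegree n p d) (count n d)
  nonCrossing-cardinality d = record
    { to        = λ k → code⇒partition (code k)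
    ; cong      = λ { refl → ⇔.refl }
    ; bijective = injective , surjective
    }
    where
    code : Fin (count n d) → Code n d
    code = Inverse.to (count↔Code n d)

    injective : ∀ {k l} → (∀ {B} → B ∈ₗ blocks (partition (code k)) ⇔ B ∈ₗ blocks (partition (code l))) → k ≡ l
    injective {k} {l} same = trans (sym (Inverse.strictlyInverseʳ (count↔Code n d) k))
      (trans (cong (Inverse.from (count↔Code n d)) (code-≡ (code-injective (code k) (code l) (λ B → same))))
             (Inverse.strictlyInverseʳ (count↔Code n d) l))
      where
      code-≡ : ∀ {c c′ : Code n d} → (d , c) ≡ (d , c′) → c ≡ c′
      code-≡ refl = refl

    surjective : ∀ P → ∃ λ k → ∀ {l} → l ≡ k → ∀ {B} →
                 B ∈ₗ blocks (partition (code l)) ⇔ B ∈ₗ blocks (proj₁ P)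
    surjective (P , P-nc , degree) =
      let c , c∼P = partition⇒code P P-nc degree in
      Inverse.from (count↔Code n d) c , λ { refl {B} →
        subst (λ c → B ∈ₗ blocks (partition c) ⇔ B ∈ₗ blocks P)
          (sym (Inverse.strictlyInverseˡ (count↔Code n d) c)) (c∼P B) }

theorem16 : ∀ {c ℓ₁ ℓ₂ ℓ₃} (F : OrderedField c ℓ₁ ℓ₂ ℓ₃) (n j : ℕ) → 1 ≤ n → 1 ≤ j → j ≤ n + 1 →
    (p : Fin (suc n) → Plane.Point F) → Plane.Convex F p →
    ∃ λ v → HasCardinality (Plane.NonCrossingOfDegree F n p (j ∸ 1)) v ×
    fromℕ/1 v ≡
    (+ j ℚ./ suc n) ℚ.* ∑[ ⌈ n + j + 1 /2⌉ ⋯ n + 1 ] (λ k →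
    fromℕ/1 ((n + 1) C k)
    ℚ.* binomial (+ k ℤ.- + j ℤ.- + 1) (2 * k ∸ (n + j + 1))
    ℚ.* fromℕ/1 (2 ^ (2 * k ∸ (n + j + 1))))
theorem16 F n (suc d) _ _ j≤n+1 p convex = count n d , nonCrossing-cardinality F p convex d , formula
  where
  j r : ℕ
  j = suc d
  r = n ∸ d

  j+r≡1+n : j + r ≡ suc n
  j+r≡1+n = cong suc (ℕ.m+[n∸m]≡n (ℕ.≤-pred (subst (j ≤_) (ℕ.+-comm n 1) j≤n+1)))

  j+[4+r]≡5+n : j + (4 + r) ≡ 5 + n
  j+[4+r]≡5+n = trans (solve 2 (λ j r → j :+ (con 4 :+ r) := con 4 :+ (j :+ r)) refl j r)
    (cong (λ x → 4 + x) j+r≡1+n)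
    where open ℕ.+-*-Solver

  formula : fromℕ/1 (count n d) ≡ (+ j ℚ./ suc n) ℚ.* ∑[ ⌈ n + j + 1 /2⌉ ⋯ n + 1 ] (λ k →
    fromℕ/1 ((n + 1) C k)
    ℚ.* binomial (+ k ℤ.- + j ℤ.- + 1) (2 * k ∸ (n + j + 1))
    ℚ.* fromℕ/1 (2 ^ (2 * k ∸ (n + j + 1))))
  -- The lemmas speak of `suc n`, the formula of `n + 1`; only the upper limit and the binomial
  -- coefficient are transported.
  formula = subst (λ m → fromℕ/1 (count n d) ≡ (+ j ℚ./ suc n) ℚ.* ∑[ ⌈ n + j + 1 /2⌉ ⋯ m ] (λ k →
      fromℕ/1 (m C k) ℚ.* binomial (+ k ℤ.- + j ℤ.- + 1) (2 * k ∸ (n + j + 1)) ℚ.* fromℕ/1 (2 ^ (2 * k ∸ (n + j + 1)))))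
    (ℕ.+-comm 1 n)
    (trans (scale-closed n j (count n d) (power (suc n) (4 + r)) (lagrange n j (4 + r) j+[4+r]≡5+n))
           (cong ((+ j ℚ./ suc n) ℚ.*_) (sym (sum-closed n j r j+r≡1+n))))
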